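{- Let $m\geq 2$, let $G$ be a connected unicyclic graph on $2m$ vertices with matching number $m$, and let $D$ be an orientation of $G$. Then $$M_1(D)\leq \frac{1}{2}\left[m^2+7m-2\right],$$ with equality if and only if $D\in U^{*}_{2m,m}$.
   Context: All graphs are finite and simple. For a digraph $D=(V,A)$, $d^{+}_u$ and $d^{ - }_u$ denote the out-degree and in-degree of $u$, and $M_1(D)=\frac{1}{2}\sum_{uv\in A}(d^{+}_u+d^{ - }_v)$, where $uv$ denotes an arc from $u$ to $v$. An orientation of a graph replaces each edge $uv$ by exactly one of the arcs $uv$, $vu$. A vertex is a source if its in-degree is $0$ and a sink if its out-degree is $0$; a sink-source orientation is one in which every vertex is a source or a sink. $U_{n,m}$ denotes the graph obtained from a triangle by attaching $n-2m+1$ pendent vertices and $m-2$ paths of length $2$ (each path $w x y$ with $x,y$ new vertices) to one common vertex $w$ of the triangle; let $a,b$ be the other two triangle vertices. Define four orientations $U^{(1)}_{n,m},\dots,U^{(4)}_{n,m}$ of $U_{n,m}$: those in which (i) every arc incident with $w$ leaves $w$ and every middle vertex $x$ of an attached path $wxy$ has both arcs entering $x$, or (ii) the reverse of such an orientation; in each case the edge $ab$ may be oriented either way. For $m\neq 2,3$, $U^{*}_{2m,m}=\{U^{(1)}_{2m,m},\dots,U^{(4)}_{2m,m}\}$. $U^{*}_{4,2}$ consists of $U^{(1)}_{4,2},\dots,U^{(4)}_{4,2}$ together with the two sink-source orientations of $C_4$. $U^{*}_{6,3}$ consists of $U^{(1)}_{6,3},\dots,U^{(4)}_{6,3}$ together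 with the two sink-source orientations of the graph obtained from $C_4$ by attaching one pendent vertex to each of two adjacent vertices of the cycle. -}

module Defs where

open import Data.Bool using (Bool; true; false; _∧_; _∨_; _xor_; if_then_else_; not)
open import Data.Nat using (ℕ; zero; suc; _+_; _*_; _≤_; _≡ᵇ_; _<ᵇ_)
open import Data.Fin using (Fin; toℕ)
open import Data.Fin.Permutation using (Permutation′; _⟨$⟩ʳ_)
open import Data.Nat.ListAction using (sum)
open import Data.List using (List; []; _∷_; map; allFin; length; concatMap; _++_)
open import Data.List.Relation.Unary.All using (All)
open import Data.List.Relation.Unary.Any using (Any)
open import Data.List.Relation.Unary.Unique.Propositional using (Unique)
open import Data.Product using (Σ; _×_; _,_)
open import Relation.Binary.PropositionalEquality using (_≡_)

sumF : {n : ℕ} → (Fin n → ℕ) → ℕ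
sumF {n} f = sum (map f (allFin n))

record SimpleGraph (n : ℕ) : Set where
  field
    adj    : Fin n → Fin n → Bool
    sym    : ∀ u v → adj u v ≡ adj v u
    irrefl : ∀ u → adj u u ≡ false
open SimpleGraph public

edgeCount : {n : ℕ} → SimpleGraph n → ℕ
edgeCount G = sumF (λ u → sumF (λ v →
  if adj G u v ∧ (toℕ u <ᵇ toℕ v) then 1 else 0))

data Reach {n : ℕ} (G : SimpleGraph n) : Fin n → Fin n → Set where
  here : ∀ {u} → Reach G u u
  step : ∀ {u w v} → adj G u w ≡ true → Reach G w v → Reach G u v

Connected : {n : ℕ} → SimpleGraph n → Set
Connected G = ∀ u v → Reach G u v

ConnectedUnicyclic : {n : ℕ} → SimpleGraph n → Set
ConnectedUnicyclic {n} G = Connected G × (edgeCount G ≡ n)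

endpoints : {n : ℕ} → List (Fin n × Fin n) → List (Fin n)
endpoints = concatMap (λ { (u , v) → u ∷ v ∷ [] })

IsMatching : {n : ℕ} → SimpleGraph n → List (Fin n × Fin n) → Set
IsMatching G M = All (λ { (u , v) → adj G u v ≡ true }) M × Unique (endpoints M)

MatchingNumber : {n : ℕ} → SimpleGraph n → ℕ → Set
MatchingNumber G k =
  Σ _ (λ M → IsMatching G M × length M ≡ k)
  × (∀ M → IsMatching G M → length M ≤ k)

Digraph : ℕ → Set
Digraph n = Fin n → Fin n → Bool

IsOrientation : {n : ℕ} → SimpleGraph n → Digraph n → Set
IsOrientation G D = ∀ u v →
  (D u v ≡ true → adj G u v ≡ true) × (adj G u v ≡ D u v xor D v u)

outdeg : {n : ℕ} → Digraph n → Fin n → ℕ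
outdeg D u = sumF (λ v → if D u v then 1 else 0)

indeg : {n : ℕ} → Digraph n → Fin n → ℕ
indeg D v = sumF (λ u → if D u v then 1 else 0)

twiceM1 : {n : ℕ} → Digraph n → ℕ
twiceM1 D = sumF (λ u → sumF (λ v →
  if D u v then outdeg D u + indeg D v else 0))

-- The extremal digraphs, labelled by natural numbers.
-- U_{2m,m}: w = 0, triangle vertices a = 1, b = 2, pendent vertex 3,
-- and for j = 0..m-3 the path w x_j y_j with x_j = 4+2j, y_j = 5+2j.

evenᵇ : ℕ → Bool
evenᵇ zero = true
evenᵇ (suc k) = not (evenᵇ k)

-- targets of arcs leaving w: a, b, the pendent vertex, and the x_j
nbrW : ℕ → Bool
nbrW 0 = false
nbrW 1 = true
nbrW 2 = true
nbrW 3 = true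
nbrW (suc (suc (suc (suc k)))) = evenᵇ k

-- arc y_j → x_j
yx : ℕ → ℕ → Bool
yx u v = (u ≡ᵇ suc v) ∧ (4 Data.Nat.≤ᵇ v) ∧ evenᵇ v

Uarc : Bool → ℕ → ℕ → Bool
Uarc ab u v = ((u ≡ᵇ 0) ∧ nbrW v) ∨ yx u v ∨
  (if ab then (u ≡ᵇ 1) ∧ (v ≡ᵇ 2) else (u ≡ᵇ 2) ∧ (v ≡ᵇ 1))

rev : (ℕ → ℕ → Bool) → ℕ → ℕ → Bool
rev E u v = E v u

Ufour : List (ℕ → ℕ → Bool)
Ufour = Uarc true ∷ Uarc false ∷ rev (Uarc true) ∷ rev (Uarc false) ∷ []

-- sink-source orientation of C_4 = 0-1-2-3-0 (sources 0,2)
c4ss : ℕ → ℕ → Bool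
c4ss u v = ((u ≡ᵇ 0) ∨ (u ≡ᵇ 2)) ∧ ((v ≡ᵇ 1) ∨ (v ≡ᵇ 3))

-- C_4 = 0-1-2-3-0 with pendent 4 at 0 and pendent 5 at 1;
-- sink-source orientation with sources {0,2,5}, sinks {1,3,4}
c4ppss : ℕ → ℕ → Bool
c4ppss u v = c4ss u v ∨ ((u ≡ᵇ 0) ∧ (v ≡ᵇ 4)) ∨ ((u ≡ᵇ 5) ∧ (v ≡ᵇ 1))

extra : ℕ → List (ℕ → ℕ → Bool)
extra 2 = c4ss ∷ rev c4ss ∷ []
extra 3 = c4ppss ∷ rev c4ppss ∷ []
extra _ = []

Ustar-list : ℕ → List (ℕ → ℕ → Bool)
Ustar-list m = Ufour ++ extra m

IsoTo : {n : ℕ} → Digraph n → (ℕ → ℕ → Bool) → Set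
IsoTo {n} D E = Σ (Permutation′ n) (λ σ →
  ∀ u v → D u v ≡ E (toℕ (σ ⟨$⟩ʳ u)) (toℕ (σ ⟨$⟩ʳ v)))

InUstar : (m : ℕ) → Digraph (2 * m) → Set
InUstar m D = Any (IsoTo D) (Ustar-list m)

{-# OPTIONS --safe #-}
module Submission where

-- Fix a perfect matching μ. Let q be the indicator of the m arcs outside μ, h the number of such
-- arcs at a vertex, Λ = Σ d⁺d⁻, and Δ the number of ordered pairs of disjoint arcs outside μ.
-- Since d⁺ + d⁻ = h + 1 and 2 M₁ = Σ (d⁺² + d⁻²), counting pairs of arcs outside μ by their common
-- endpoints gives 2 M₁ + 2Λ + Δ = m² + 7m, so it remains to show 2Λ + Δ ≥ 2 and find the equality cases.
-- If Δ = 0, the arcs outside μ form a triangle or a star. In both cases the graph contains a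
-- triangle, one of whose vertices has an arc in and an arc out, so Λ ≥ 1. Equality rules out the
-- triangle, and the star together with μ is U_{2m,m}, all of whose vertices but one are sources or sinks.
-- If Δ ≠ 0, then Δ ≥ 2. In the case of equality every vertex is a source or a sink, and all arcs
-- outside μ except two disjoint ones meet every other arc outside μ. At most one such further arc
-- exists, which leaves C₄ (m = 2) and C₄ with two pendent vertices (m = 3).

open import Defs hiding (sym)
open import Data.Bool using (Bool; true; false; _∧_; _∨_; _xor_; not; if_then_else_; T)
open import Data.Bool.Properties using (not-involutive)
open import Data.Fin as Fin using (Fin; toℕ; fromℕ<)
import Data.Fin.Properties as Fin
open import Data.Fin.Permutation using (Permutation′; permutation; _⟨$⟩ʳ_; _⟨$⟩ˡ_; inverseˡ; inverseʳ)
open import Data.List using (List; []; _∷_; map; allFin; length; lookup; filter; cartesianProduct; _++_)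
open import Data.List.Membership.Propositional using (_∈_; _∉_)
open import Data.List.Membership.Propositional.Properties
  using (∈-allFin; ∈-cartesianProduct⁺; ∈-∃++; ∈-++⁺ˡ; ∈-++⁺ʳ; ∈-++⁻; ∈-filter⁺; ∈-filter⁻)
open import Data.List.Properties using (map-cong; map-∘; map-++; length-tabulate)
open import Data.List.Relation.Unary.All as All using (All; []; _∷_)
open import Data.List.Relation.Unary.AllPairs using ([]; _∷_)
open import Data.List.Relation.Unary.Any as Any using (Any; here; there; any?)
open import Data.List.Relation.Unary.Any.Properties using (lookup-index; ++⁺ˡ; ++⁺ʳ)
open import Data.List.Relation.Unary.Unique.Propositional using (Unique)
open import Data.List.Relation.Unary.Unique.Propositional.Properties
  using (allFin⁺; cartesianProduct⁺; filter⁺)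
  renaming (map⁺ to Unique-map⁺)
open import Data.Nat using (ℕ; zero; suc; _+_; _*_; _≤_; _<_; z≤n; s≤s; _≡ᵇ_; _<ᵇ_)
open import Data.Nat.ListAction using (sum)
open import Data.Nat.ListAction.Properties using (sum-++)
open import Data.Nat.Properties hiding (_≟_)
open import Data.Nat.Solver using (module +-*-Solver)
open import Data.Product using (Σ; ∃; ∃₂; _×_; _,_; proj₁; proj₂)
open import Data.Product.Properties using (≡-dec)
open import Data.Sum using (_⊎_; inj₁; inj₂; [_,_]′; swap)
open import Function using (_∘_; _⇔_; mk⇔; flip)
open import Relation.Binary.Definitions using (DecidableEquality)
open import Relation.Binary.PropositionalEquality
  using (_≡_; _≢_; refl; sym; trans; cong; cong₂; subst; subst₂; ≢-sym; module ≡-Reasoning)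
open import Relation.Nullary using (¬_; Dec; yes; no; does; contradiction; ¬?)
open import Relation.Nullary.Decidable using (_⊎-dec_; _×-dec_; dec-true; dec-false)

open +-*-Solver using (solve; _:=_; _:+_; _:*_; con)

-- Finite sums over lists

∑ : {A : Set} → List A → (A → ℕ) → ℕ
∑ xs f = sum (map f xs)

syntax ∑ xs (λ x → e) = ∑[ x ∈ xs ] e

infix 10 ∑

χ : Bool → ℕ
χ b = if b then 1 else 0

χ≤1 : ∀ b → χ b ≤ 1
χ≤1 true = ≤-refl
χ≤1 false = z≤n

χ≢0 : ∀ {b} → χ b ≢ 0 → b ≡ true
χ≢0 {true} _ = refl
χ≢0 {false} 0≢0 = contradiction refl 0≢0

module _ {A : Set} where

  ∑-cong : (xs : List A) {f g : A → ℕ} → (∀ x → f x ≡ g x) → ∑ xs f ≡ ∑ xs g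
  ∑-cong xs eq = cong sum (map-cong eq xs)

  ∑-mono : (xs : List A) {f g : A → ℕ} → (∀ x → f x ≤ g x) → ∑ xs f ≤ ∑ xs g
  ∑-mono [] le = z≤n
  ∑-mono (x ∷ xs) le = +-mono-≤ (le x) (∑-mono xs le)

  ∑-+ : (xs : List A) (f g : A → ℕ) → ∑[ x ∈ xs ] (f x + g x) ≡ ∑ xs f + ∑ xs g
  ∑-+ [] f g = refl
  ∑-+ (x ∷ xs) f g rewrite ∑-+ xs f g =
    solve 4 (λ a b c d → a :+ b :+ (c :+ d) := a :+ c :+ (b :+ d)) refl (f x) (g x) (∑ xs f) (∑ xs g)

  ∑-* : (xs : List A) (c : ℕ) (f : A → ℕ) → ∑[ x ∈ xs ] (c * f x) ≡ c * ∑ xs f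
  ∑-* [] c f = sym (*-zeroʳ c)
  ∑-* (x ∷ xs) c f rewrite ∑-* xs c f = sym (*-distribˡ-+ c (f x) (∑ xs f))

  ∑-*ʳ : (xs : List A) (c : ℕ) (f : A → ℕ) → ∑[ x ∈ xs ] (f x * c) ≡ ∑ xs f * c
  ∑-*ʳ [] c f = refl
  ∑-*ʳ (x ∷ xs) c f rewrite ∑-*ʳ xs c f = sym (*-distribʳ-+ c (f x) (∑ xs f))

  ∑-const : (xs : List A) (c : ℕ) → ∑[ _ ∈ xs ] c ≡ length xs * c
  ∑-const [] c = refl
  ∑-const (x ∷ xs) c = cong (c +_) (∑-const xs c)

  ∑-vanish : (xs : List A) {f : A → ℕ} → (∀ x → f x ≡ 0) → ∑ xs f ≡ 0
  ∑-vanish xs eq = trans (∑-cong xs eq) (trans (∑-const xs 0) (*-zeroʳ (length xs)))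

  ∑-≤length : (xs : List A) {f : A → ℕ} → (∀ x → f x ≤ 1) → ∑ xs f ≤ length xs
  ∑-≤length xs le = ≤-trans (∑-mono xs le) (≤-reflexive (trans (∑-const xs 1) (*-identityʳ _)))

  ∑-++ : (xs ys : List A) (f : A → ℕ) → ∑ (xs ++ ys) f ≡ ∑ xs f + ∑ ys f
  ∑-++ xs ys f = trans (cong sum (map-++ f xs ys)) (sum-++ (map f xs) (map f ys))

  ∑-≢0 : (xs : List A) {f : A → ℕ} → ∑ xs f ≢ 0 → ∃ λ x → x ∈ xs × f x ≢ 0
  ∑-≢0 [] 0≢0 = contradiction refl 0≢0
  ∑-≢0 (x ∷ xs) {f} s≢0 with f x in fx
  ... | suc _ = x , here refl , λ fx≡0 → contradiction (trans (sym fx) fx≡0) λ ()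
  ... | zero = let y , y∈xs , fy = ∑-≢0 xs s≢0 in y , there y∈xs , fy

  ∈-remove : ∀ {x y : A} as {bs} → y ∈ as ++ x ∷ bs → y ≢ x → y ∈ as ++ bs
  ∈-remove as y∈ y≢x with ∈-++⁻ as y∈
  ... | inj₁ y∈as = ∈-++⁺ˡ y∈as
  ... | inj₂ (here y≡x) = contradiction y≡x y≢x
  ... | inj₂ (there y∈bs) = ∈-++⁺ʳ as y∈bs

  -- Each `x` with `f x` nonzero is split off from `ys`; since `xs` has no repetition, its remaining
  -- entries still find their place in what is left of `ys`.
  ∑-support : {xs ys : List A} (f : A → ℕ) → Unique xs →
    (∀ {x} → x ∈ xs → f x ≢ 0 → x ∈ ys) → ∑ xs f ≤ ∑ ys f
  ∑-support {[]} f _ _ = z≤n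
  ∑-support {x ∷ xs} {ys} f (x≢ ∷ uniq) sub with f x in fx
  ... | zero = ∑-support f uniq (sub ∘ there)
  ... | suc k with ∈-∃++ (sub (here refl) λ fx≡0 → contradiction (trans (sym fx) fx≡0) λ ())
  ...   | as , bs , refl = begin
      suc k + ∑ xs f             ≤⟨ +-monoʳ-≤ (suc k) (∑-support f uniq sub′) ⟩
      suc k + ∑ (as ++ bs) f     ≡⟨ cong₂ _+_ (sym fx) (∑-++ as bs f) ⟩
      f x + (∑ as f + ∑ bs f)    ≡⟨ solve 3 (λ a b c → a :+ (b :+ c) := b :+ (a :+ c)) refl (f x) (∑ as f) (∑ bs f) ⟩
      ∑ as f + (f x + ∑ bs f)    ≡⟨ sym (∑-++ as (x ∷ bs) f) ⟩
      ∑ (as ++ x ∷ bs) f         ∎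
    where
    open ≤-Reasoning
    sub′ : ∀ {y} → y ∈ xs → f y ≢ 0 → y ∈ as ++ bs
    sub′ y∈xs fy = ∈-remove as (sub (there y∈xs) fy) (≢-sym (All.lookup x≢ y∈xs))

  -- Contrapositive of `∑-support`, with the witness found by searching `xs`. It is the pigeonhole
  -- principle behind the choice of a further arc.
  ∑-escape : DecidableEquality A → {xs ys : List A} (f : A → ℕ) → Unique xs → ∑ ys f < ∑ xs f →
    ∃ λ x → f x ≢ 0 × x ∉ ys
  ∑-escape _≟_ {xs} {ys} f uniq lt
    with any? (λ x → ¬? (f x Data.Nat.≟ 0) ×-dec ¬? (any? (x ≟_) ys)) xs
  ... | yes p = let x , r = Any.satisfied p in x , r
  ... | no ¬p = contradiction lt (≤⇒≯ (∑-support f uniq inside))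
    where
    inside : ∀ {x} → x ∈ xs → f x ≢ 0 → x ∈ ys
    inside {x} x∈xs fx with any? (x ≟_) ys
    ... | yes x∈ys = x∈ys
    ... | no x∉ys = contradiction (Any.map (λ { refl → fx , x∉ys }) x∈xs) ¬p

  length-⊆ : {xs ys : List A} → Unique xs → (∀ {x} → x ∈ xs → x ∈ ys) → length xs ≤ length ys
  length-⊆ {xs} {ys} uniq sub = subst₂ _≤_ (ones xs) (ones ys) (∑-support (λ _ → 1) uniq λ x∈ _ → sub x∈)
    where
    ones : ∀ zs → ∑[ _ ∈ zs ] 1 ≡ length zs
    ones zs = trans (∑-const zs 1) (*-identityʳ _)

∑-swap : {A B : Set} (xs : List A) (ys : List B) (f : A → B → ℕ) →
  ∑[ x ∈ xs ] (∑[ y ∈ ys ] f x y) ≡ ∑[ y ∈ ys ] (∑[ x ∈ xs ] f x y)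
∑-swap [] ys f = sym (∑-vanish ys λ _ → refl)
∑-swap (x ∷ xs) ys f = trans (cong (∑ ys (f x) +_) (∑-swap xs ys f)) (sym (∑-+ ys (f x) _))

∑-cartesianProduct : {A B : Set} (xs : List A) (ys : List B) (f : A → B → ℕ) →
  ∑[ e ∈ cartesianProduct xs ys ] f (proj₁ e) (proj₂ e) ≡ ∑[ x ∈ xs ] (∑[ y ∈ ys ] f x y)
∑-cartesianProduct [] ys f = refl
∑-cartesianProduct (x ∷ xs) ys f = trans
  (∑-++ (map (x ,_) ys) (cartesianProduct xs ys) _)
  (cong₂ _+_ (sym (cong sum (map-∘ ys))) (∑-cartesianProduct xs ys f))

-- Sums and double sums over vertices

module FinSums (n : ℕ) where

  V : List (Fin n)
  V = allFin n

  length-V : length V ≡ n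
  length-V = length-tabulate {n = n} (λ x → x)

  infix 4 _≟_
  _≟_ : DecidableEquality (Fin n)
  _≟_ = Fin._≟_

  ∑-δ : (u : Fin n) (f : Fin n → ℕ) → ∑[ x ∈ V ] (χ (does (u ≟ x)) * f x) ≡ f u
  ∑-δ u f = ≤-antisym
    (≤-trans (∑-support _ (allFin⁺ n) in-u) (≤-reflexive (trans (+-identityʳ _) at-u)))
    (≤-trans (≤-reflexive (trans (sym at-u) (sym (+-identityʳ _))))
      (∑-support {xs = u ∷ []} {V} _ ([] ∷ []) λ _ _ → ∈-allFin _))
    where
    g : Fin n → ℕ
    g x = χ (does (u ≟ x)) * f x
    at-u : g u ≡ f u
    at-u rewrite dec-true (u ≟ u) refl = +-identityʳ _
    in-u : ∀ {x} → x ∈ V → g x ≢ 0 → x ∈ u ∷ []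
    in-u {x} _ gx with u ≟ x
    ... | yes u≡x = here (sym u≡x)
    ... | no _ = contradiction refl gx

  ∑-injection-≤ : {f : Fin n → Fin n} → (∀ {x y} → f x ≡ f y → x ≡ y) → (g : Fin n → ℕ) →
    ∑[ x ∈ V ] g (f x) ≤ ∑ V g
  ∑-injection-≤ inj g = ≤-trans (≤-reflexive (cong sum (map-∘ V)))
    (∑-support g (Unique-map⁺ inj (allFin⁺ n)) λ _ _ → ∈-allFin _)

  -- A permutation and its inverse are both injective, and each of the two injections gives one
  -- inequality.
  ∑-permute : (σ : Permutation′ n) (g : Fin n → ℕ) → ∑[ x ∈ V ] g (σ ⟨$⟩ʳ x) ≡ ∑ V g
  ∑-permute σ g = ≤-antisym
    (∑-injection-≤ (λ eq → trans (sym (inverseˡ σ)) (trans (cong (σ ⟨$⟩ˡ_) eq) (inverseˡ σ))) g)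
    (≤-trans (≤-reflexive (∑-cong V λ x → cong g (sym (inverseʳ σ))))
      (∑-injection-≤ (λ eq → trans (sym (inverseʳ σ)) (trans (cong (σ ⟨$⟩ʳ_) eq) (inverseʳ σ)))
        (λ x → g (σ ⟨$⟩ʳ x))))

  ∑₂ : (Fin n → Fin n → ℕ) → ℕ
  ∑₂ f = ∑[ u ∈ V ] (∑[ v ∈ V ] f u v)

  ∑₂-cong : {f g : Fin n → Fin n → ℕ} → (∀ u v → f u v ≡ g u v) → ∑₂ f ≡ ∑₂ g
  ∑₂-cong eq = ∑-cong V λ u → ∑-cong V (eq u)

  ∑₂-+ : (f g : Fin n → Fin n → ℕ) → ∑₂ (λ u v → f u v + g u v) ≡ ∑₂ f + ∑₂ g
  ∑₂-+ f g = trans (∑-cong V λ u → ∑-+ V (f u) (g u)) (∑-+ V _ _)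

  ∑₂-*ʳ : (f : Fin n → Fin n → ℕ) (c : ℕ) → ∑₂ (λ u v → f u v * c) ≡ ∑₂ f * c
  ∑₂-*ʳ f c = trans (∑-cong V λ u → ∑-*ʳ V c (f u)) (∑-*ʳ V c _)

  ∑₂-swap : (f : Fin n → Fin n → ℕ) → ∑₂ f ≡ ∑₂ (λ u v → f v u)
  ∑₂-swap = ∑-swap V V

  ∑₂-*row : (f : Fin n → Fin n → ℕ) (c : Fin n → ℕ) →
    ∑₂ (λ u v → f u v * c u) ≡ ∑[ u ∈ V ] ((∑[ v ∈ V ] f u v) * c u)
  ∑₂-*row f c = ∑-cong V λ u → ∑-*ʳ V (c u) (f u)

  ∑₂-*col : (f : Fin n → Fin n → ℕ) (c : Fin n → ℕ) →
    ∑₂ (λ u v → f u v * c v) ≡ ∑[ v ∈ V ] ((∑[ u ∈ V ] f u v) * c v)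
  ∑₂-*col f c = trans (∑₂-swap _) (∑₂-*row (λ u v → f v u) c)

  ∑₂-δrow : (f : Fin n → Fin n → ℕ) (a : Fin n) →
    ∑₂ (λ u v → f u v * χ (does (a ≟ u))) ≡ ∑[ v ∈ V ] f a v
  ∑₂-δrow f a = trans (∑₂-*row f _) (trans (∑-cong V λ u → *-comm (∑ V (f u)) _) (∑-δ a _))

  ∑₂-δcol : (f : Fin n → Fin n → ℕ) (a : Fin n) →
    ∑₂ (λ u v → f u v * χ (does (a ≟ v))) ≡ ∑[ u ∈ V ] f u a
  ∑₂-δcol f a = trans (∑₂-swap _) (∑₂-δrow (λ u v → f v u) a)

  V² : List (Fin n × Fin n)
  V² = cartesianProduct V V

  V²-unique : Unique V²
  V²-unique = cartesianProduct⁺ (allFin⁺ n) (allFin⁺ n)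

  ∈-V² : ∀ {e} → e ∈ V²
  ∈-V² = ∈-cartesianProduct⁺ (∈-allFin _) (∈-allFin _)

  ∑V² : (f : Fin n → Fin n → ℕ) → ∑[ e ∈ V² ] f (proj₁ e) (proj₂ e) ≡ ∑₂ f
  ∑V² = ∑-cartesianProduct V V

-- Orientations carrying a perfect matching

record MatchedOrientation (m : ℕ) (D : Digraph (2 * m)) : Set where
  field
    μ            : Fin (2 * m) → Fin (2 * m)
    μ-involutive : ∀ u → μ (μ u) ≡ u
    μ-arc        : ∀ u → D u (μ u) ≡ true ⊎ D (μ u) u ≡ true
    loopless     : ∀ {u} → D u u ≢ true
    asymmetric   : ∀ {u v} → D u v ≡ true → D v u ≢ true
    arc-count    : FinSums.∑₂ (2 * m) (λ u v → χ (D u v)) ≡ 2 * m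

-- Reversal exchanges sources and sinks and keeps `μ`, so mirror-image cases need only one argument.
reverse : ∀ {m D} → MatchedOrientation m D → MatchedOrientation m (flip D)
reverse {m} X = record
  { μ = μ
  ; μ-involutive = μ-involutive
  ; μ-arc = λ u → swap (μ-arc u)
  ; loopless = loopless
  ; asymmetric = asymmetric
  ; arc-count = trans (∑₂-swap _) arc-count
  }
  where
  open MatchedOrientation X
  open FinSums (2 * m)

-- The index in terms of vertex degrees

χ-if : ∀ b k → (if b then k else 0) ≡ χ b * k
χ-if true k = sym (+-identityʳ k)
χ-if false k = refl

module _ {n : ℕ} where

  open FinSums n

  -- The value `outdeg D u` is added once for every arc leaving `u`, hence `outdeg D u` times;
  -- in-degrees behave alike at the heads.
  twiceM1-squares : (D : Digraph n) →
    twiceM1 D ≡ ∑[ u ∈ V ] (outdeg D u * outdeg D u) + ∑[ v ∈ V ] (indeg D v * indeg D v)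
  twiceM1-squares D = begin
    twiceM1 D
      ≡⟨ ∑₂-cong (λ u v → trans (χ-if (D u v) _) (*-distribˡ-+ (χ (D u v)) _ _)) ⟩
    ∑₂ (λ u v → χ (D u v) * outdeg D u + χ (D u v) * indeg D v)
      ≡⟨ ∑₂-+ (λ u v → χ (D u v) * outdeg D u) (λ u v → χ (D u v) * indeg D v) ⟩
    ∑₂ (λ u v → χ (D u v) * outdeg D u) + ∑₂ (λ u v → χ (D u v) * indeg D v)
      ≡⟨ cong₂ _+_ (∑₂-*row (λ u v → χ (D u v)) (outdeg D)) (∑₂-*col (λ u v → χ (D u v)) (indeg D)) ⟩
    ∑[ u ∈ V ] (outdeg D u * outdeg D u) + ∑[ v ∈ V ] (indeg D v * indeg D v) ∎
    where open ≡-Reasoning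

  twiceM1-flip : (D : Digraph n) → twiceM1 (flip D) ≡ twiceM1 D
  twiceM1-flip D = trans (twiceM1-squares (flip D))
    (trans (+-comm (∑[ u ∈ V ] (indeg D u * indeg D u)) _) (sym (twiceM1-squares D)))

-- Common endpoints of two arcs

module _ {n : ℕ} where

  -- The alternatives are grouped by the endpoints of the first arc, so that `swap` exchanges `u`
  -- and `v`.
  Touch : Fin n → Fin n → Fin n → Fin n → Set
  Touch u v x y = (u ≡ x ⊎ u ≡ y) ⊎ (v ≡ x ⊎ v ≡ y)

  touch? : ∀ u v x y → Dec (Touch u v x y)
  touch? u v x y = ((u Fin.≟ x) ⊎-dec (u Fin.≟ y)) ⊎-dec ((v Fin.≟ x) ⊎-dec (v Fin.≟ y))

  δ : Fin n → Fin n → ℕ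
  δ a x = χ (does (a Fin.≟ x))

  apart : Fin n → Fin n → Fin n → Fin n → ℕ
  apart u v x y = χ (not (does (touch? u v x y)))

  -- Two arcs that are not reverse to each other share no endpoint, one, or both, and in the last
  -- case they are equal. The product on the right detects that case.
  common-endpoints : ∀ u v x y → u ≢ v → x ≢ y → (u ≡ y → v ≢ x) →
    δ u x + δ u y + (δ v x + δ v y) + apart u v x y ≡ 1 + δ u x * δ v y
  common-endpoints u v x y u≢v x≢y anti with u Fin.≟ x | u Fin.≟ y | v Fin.≟ x | v Fin.≟ y
  ... | yes refl | yes refl | _ | _ = contradiction refl x≢y
  ... | yes refl | _ | yes refl | _ = contradiction refl u≢v
  ... | _ | yes refl | _ | yes refl = contradiction refl u≢v
  ... | _ | _ | yes refl | yes refl = contradiction refl x≢y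
  ... | _ | yes u≡y | yes v≡x | _ = contradiction v≡x (anti u≡y)
  ... | yes _ | no _ | no _ | yes _ = refl
  ... | yes _ | no _ | no _ | no _ = refl
  ... | no _ | yes _ | no _ | no _ = refl
  ... | no _ | no _ | yes _ | no _ = refl
  ... | no _ | no _ | no _ | yes _ = refl
  ... | no _ | no _ | no _ | no _ = refl

  Touch-sym : ∀ {u v x y : Fin n} → Touch u v x y → Touch x y u v
  Touch-sym (inj₁ (inj₁ eq)) = inj₁ (inj₁ (sym eq))
  Touch-sym (inj₁ (inj₂ eq)) = inj₂ (inj₁ (sym eq))
  Touch-sym (inj₂ (inj₁ eq)) = inj₁ (inj₂ (sym eq))
  Touch-sym (inj₂ (inj₂ eq)) = inj₂ (inj₂ (sym eq))

  apart-≢ : ∀ {u v x y : Fin n} → ¬ Touch u v x y → (u , v) ≢ (x , y)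
  apart-≢ ¬t refl = ¬t (inj₁ (inj₁ refl))

-- Counting pairs of arcs outside the matching

module Counting {m : ℕ} {D : Digraph (2 * m)} (X : MatchedOrientation m D) where

  open MatchedOrientation X public

  n : ℕ
  n = 2 * m

  open FinSums n public

  infix 4 _⟶_ _⇢_

  _⟶_ : Fin n → Fin n → Set
  u ⟶ v = D u v ≡ true

  _⇢_ : Fin n → Fin n → Set
  u ⇢ v = u ⟶ v × μ u ≢ v

  q : Fin n → Fin n → ℕ
  q u v = χ (D u v ∧ not (does (μ u ≟ v)))

  q≤1 : ∀ u v → q u v ≤ 1
  q≤1 u v = χ≤1 (D u v ∧ _)

  ⇢⇒q : ∀ {u v} → u ⇢ v → q u v ≡ 1
  ⇢⇒q {u} {v} (uv , ≢v) rewrite uv | dec-false (μ u ≟ v) ≢v = refl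

  q⇒⇢ : ∀ {u v} → q u v ≢ 0 → u ⇢ v
  q⇒⇢ {u} {v} q≢0 with D u v | μ u ≟ v
  ... | true | no ≢v = refl , ≢v
  ... | true | yes _ = contradiction refl q≢0
  ... | false | _ = contradiction refl q≢0

  μ-flip : ∀ {u v} → μ u ≡ v → μ v ≡ u
  μ-flip {u} refl = μ-involutive u

  μ-injective : ∀ {u v} → μ u ≡ μ v → u ≡ v
  μ-injective {u} {v} eq = trans (sym (μ-involutive u)) (trans (cong μ eq) (μ-involutive v))

  ⟶⇒≢ : ∀ {u v} → u ⟶ v → u ≢ v
  ⟶⇒≢ u⟶v refl = loopless u⟶v

  d⁺ d⁻ h : Fin n → ℕ
  d⁺ = outdeg D
  d⁻ = indeg D
  h u = ∑[ x ∈ V ] q u x + ∑[ x ∈ V ] q x u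

  -- A matched pair carries exactly one arc, which `q` leaves out. The factor `1` gives the last
  -- term the form summed by `∑-δ`.
  χ-arcs : ∀ u v → χ (D u v) + χ (D v u) ≡ q u v + q v u + χ (does (μ u ≟ v)) * 1
  χ-arcs u v with μ u ≟ v | μ v ≟ u
  ... | yes refl | no ≢u = contradiction (μ-involutive u) ≢u
  ... | no ≢v | yes refl = contradiction (μ-involutive v) ≢v
  ... | no _ | no _ = go (D u v) (D v u)
    where
    go : ∀ b c → χ b + χ c ≡ χ (b ∧ true) + χ (c ∧ true) + 0
    go true true = refl
    go true false = refl
    go false true = refl
    go false false = refl
  ... | yes refl | yes _ with D u (μ u) in p | D (μ u) u in r | μ-arc u
  ...   | true | true | _ = contradiction r (asymmetric p)
  ...   | true | false | _ = refl
  ...   | false | true | _ = refl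
  ...   | false | false | inj₁ ()
  ...   | false | false | inj₂ ()

  degree : ∀ u → d⁺ u + d⁻ u ≡ h u + 1
  degree u = begin
    d⁺ u + d⁻ u                                     ≡⟨ sym (∑-+ V _ _) ⟩
    ∑[ v ∈ V ] (χ (D u v) + χ (D v u))              ≡⟨ ∑-cong V (χ-arcs u) ⟩
    ∑[ v ∈ V ] (q u v + q v u + χ (does (μ u ≟ v)) * 1)
      ≡⟨ trans (∑-+ V _ _) (cong₂ _+_ (∑-+ V _ _) (∑-δ (μ u) (λ _ → 1))) ⟩
    h u + 1 ∎
    where open ≡-Reasoning

  ∑h≡2∑q : ∑ V h ≡ 2 * ∑₂ q
  ∑h≡2∑q = begin
    ∑ V h                        ≡⟨ ∑-+ V _ _ ⟩
    ∑₂ q + ∑₂ (λ u v → q v u)    ≡⟨ cong (∑₂ q +_) (sym (∑₂-swap q)) ⟩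
    ∑₂ q + ∑₂ q                  ≡⟨ cong (∑₂ q +_) (sym (+-identityʳ _)) ⟩
    2 * ∑₂ q                     ∎
    where open ≡-Reasoning

  ∑1 : ∑[ u ∈ V ] 1 ≡ n
  ∑1 = trans (∑-const V 1) (trans (*-identityʳ _) length-V)

  -- The degrees sum to twice the number `n` of arcs. Each vertex spends one on its matching edge,
  -- so `n` remains for `h`.
  ∑h : ∑ V h ≡ n
  ∑h = +-cancelʳ-≡ n _ _ (begin
    ∑ V h + n                     ≡⟨ cong (∑ V h +_) (sym ∑1) ⟩
    ∑ V h + ∑[ u ∈ V ] 1          ≡⟨ sym (∑-+ V h _) ⟩
    ∑[ u ∈ V ] (h u + 1)          ≡⟨ ∑-cong V (λ u → sym (degree u)) ⟩
    ∑[ u ∈ V ] (d⁺ u + d⁻ u)      ≡⟨ ∑-+ V d⁺ d⁻ ⟩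
    ∑ V d⁺ + ∑ V d⁻               ≡⟨ cong₂ _+_ arc-count (trans (∑₂-swap _) arc-count) ⟩
    n + n                         ∎)
    where open ≡-Reasoning

  ∑q : ∑₂ q ≡ m
  ∑q = *-cancelˡ-≡ _ _ 2 (trans (sym ∑h≡2∑q) ∑h)

  S : Fin n → Fin n → ℕ
  S u v = ∑₂ (λ x y → q x y * apart u v x y)

  -- Summing `common-endpoints` over the `m` arcs `x → y` outside `μ` counts each of them once and
  -- the arc `u → v` itself once more.
  neighbourhood : ∀ {u v} → u ⇢ v → h u + h v + S u v ≡ m + 1
  neighbourhood {u} {v} (u⟶v , ≢v) = begin
    h u + h v + S u v
      ≡⟨ cong (_+ S u v) (sym (cong₂ _+_ (rows u) (rows v))) ⟩
    ∑₂ (λ x y → q x y * δ u x + q x y * δ u y)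
      + ∑₂ (λ x y → q x y * δ v x + q x y * δ v y) + S u v
      ≡⟨ sym (trans (∑₂-+ _ _) (cong (_+ S u v) (∑₂-+ _ _))) ⟩
    ∑₂ (λ x y → q x y * δ u x + q x y * δ u y
      + (q x y * δ v x + q x y * δ v y) + q x y * apart u v x y)
      ≡⟨ ∑₂-cong pointwise ⟩
    ∑₂ (λ x y → q x y + q x y * δ v y * δ u x)
      ≡⟨ trans (∑₂-+ _ _) (cong₂ _+_ ∑q (trans (∑₂-δrow (λ x y → q x y * δ v y) u)
           (∑-cong V λ y → *-comm (q u y) (δ v y)))) ⟩
    m + ∑[ y ∈ V ] (δ v y * q u y)
      ≡⟨ cong (m +_) (trans (∑-δ v (q u)) (⇢⇒q (u⟶v , ≢v))) ⟩
    m + 1 ∎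
    where
    open ≡-Reasoning
    rows : ∀ a → ∑₂ (λ x y → q x y * δ a x + q x y * δ a y) ≡ h a
    rows a = trans (∑₂-+ _ _) (cong₂ _+_ (∑₂-δrow q a) (∑₂-δcol q a))
    pointwise : ∀ x y → q x y * δ u x + q x y * δ u y
      + (q x y * δ v x + q x y * δ v y) + q x y * apart u v x y
      ≡ q x y + q x y * δ v y * δ u x
    pointwise x y with q x y in qxy
    ... | zero = refl
    ... | suc k = trans
      (solve 6 (λ k a b c d e → k :* a :+ k :* b :+ (k :* c :+ k :* d) :+ k :* e
        := k :* (a :+ b :+ (c :+ d) :+ e)) refl (suc k) (δ u x) (δ u y) (δ v x) (δ v y) (apart u v x y))
      (trans (cong (suc k *_) (common-endpoints u v x y (⟶⇒≢ u⟶v) (⟶⇒≢ x⟶y)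
          λ { refl refl → asymmetric u⟶v x⟶y }))
        (solve 3 (λ k a d → k :* (con 1 :+ a :* d) := k :+ k :* d :* a) refl (suc k) (δ u x) (δ v y)))
      where
      x⟶y : x ⟶ y
      x⟶y = proj₁ (q⇒⇢ λ q≡0 → contradiction (trans (sym qxy) q≡0) λ ())

  Λ Δ : ℕ
  Λ = ∑[ u ∈ V ] (d⁺ u * d⁻ u)
  Δ = ∑₂ (λ u v → q u v * S u v)

  -- When `neighbourhood` is summed over all arcs outside `μ`, the value `h u` occurs once for each
  -- such arc at `u`, hence `h u` times.
  ∑h²+Δ : ∑[ u ∈ V ] (h u * h u) + Δ ≡ m * (m + 1)
  ∑h²+Δ = begin
    ∑[ u ∈ V ] (h u * h u) + Δ
      ≡⟨ cong (_+ Δ) (trans (∑-cong V λ u → *-distribʳ-+ (h u) (∑[ x ∈ V ] q u x) _) (∑-+ V _ _)) ⟩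
    ∑[ u ∈ V ] (∑[ v ∈ V ] q u v * h u) + ∑[ v ∈ V ] (∑[ u ∈ V ] q u v * h v) + Δ
      ≡⟨ cong (_+ Δ) (sym (cong₂ _+_ (∑₂-*row q h) (∑₂-*col q h))) ⟩
    ∑₂ (λ u v → q u v * h u) + ∑₂ (λ u v → q u v * h v) + Δ
      ≡⟨ sym (trans (∑₂-+ _ _) (cong (_+ Δ) (∑₂-+ _ _))) ⟩
    ∑₂ (λ u v → q u v * h u + q u v * h v + q u v * S u v)
      ≡⟨ ∑₂-cong pointwise ⟩
    ∑₂ (λ u v → q u v * (m + 1))
      ≡⟨ trans (∑₂-*ʳ q (m + 1)) (cong (_* (m + 1)) ∑q) ⟩
    m * (m + 1) ∎
    where
    open ≡-Reasoning
    pointwise : ∀ u v → q u v * h u + q u v * h v + q u v * S u v ≡ q u v * (m + 1)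
    pointwise u v with q u v in quv
    ... | zero = refl
    ... | suc k = trans
      (solve 4 (λ k a b c → k :* a :+ k :* b :+ k :* c := k :* (a :+ b :+ c)) refl (suc k) (h u) (h v) (S u v))
      (cong (suc k *_) (neighbourhood (q⇒⇢ λ q≡0 → contradiction (trans (sym quv) q≡0) λ ())))

  -- The term `2 * Λ` completes the squares to `(d⁺ + d⁻)² = (h + 1)²`. As `h` sums to `n`, their
  -- linear and constant parts add up to `3 * n = 6 * m`.
  twiceM1-defect : twiceM1 D + (2 * Λ + Δ) ≡ m * m + 7 * m
  twiceM1-defect = begin
    twiceM1 D + (2 * Λ + Δ)
      ≡⟨ sym (+-assoc (twiceM1 D) (2 * Λ) Δ) ⟩
    twiceM1 D + 2 * Λ + Δ
      ≡⟨ cong₂ (λ a b → a + b + Δ) (trans (twiceM1-squares D) (sym (∑-+ V _ _))) (sym (∑-* V 2 _)) ⟩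
    ∑[ u ∈ V ] (d⁺ u * d⁺ u + d⁻ u * d⁻ u) + ∑[ u ∈ V ] (2 * (d⁺ u * d⁻ u)) + Δ
      ≡⟨ cong (_+ Δ) (sym (∑-+ V _ _)) ⟩
    ∑[ u ∈ V ] (d⁺ u * d⁺ u + d⁻ u * d⁻ u + 2 * (d⁺ u * d⁻ u)) + Δ
      ≡⟨ cong (_+ Δ) (∑-cong V square) ⟩
    ∑[ u ∈ V ] (h u * h u + 2 * h u + 1) + Δ
      ≡⟨ cong (_+ Δ) (trans (∑-+ V _ _) (cong₂ _+_ (∑-+ V _ _) ∑1)) ⟩
    ∑[ u ∈ V ] (h u * h u) + ∑[ u ∈ V ] (2 * h u) + n + Δ
      ≡⟨ cong (λ a → ∑[ u ∈ V ] (h u * h u) + a + n + Δ) (trans (∑-* V 2 h) (cong (2 *_) ∑h)) ⟩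
    ∑[ u ∈ V ] (h u * h u) + 2 * n + n + Δ
      ≡⟨ solve 3 (λ a d m → a :+ con 2 :* (con 2 :* m) :+ con 2 :* m :+ d := a :+ d :+ con 6 :* m)
           refl (∑[ u ∈ V ] (h u * h u)) Δ m ⟩
    ∑[ u ∈ V ] (h u * h u) + Δ + 6 * m
      ≡⟨ cong (_+ 6 * m) ∑h²+Δ ⟩
    m * (m + 1) + 6 * m
      ≡⟨ solve 1 (λ m → m :* (m :+ con 1) :+ con 6 :* m := m :* m :+ con 7 :* m) refl m ⟩
    m * m + 7 * m ∎
    where
    open ≡-Reasoning
    square : ∀ u → d⁺ u * d⁺ u + d⁻ u * d⁻ u + 2 * (d⁺ u * d⁻ u) ≡ h u * h u + 2 * h u + 1
    square u = trans
      (solve 2 (λ a b → a :* a :+ b :* b :+ con 2 :* (a :* b) := (a :+ b) :* (a :+ b)) refl (d⁺ u) (d⁻ u))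
      (trans (cong (λ k → k * k) (degree u))
        (solve 1 (λ a → (a :+ con 1) :* (a :+ con 1) := a :* a :+ con 2 :* a :+ con 1) refl (h u)))

-- Vertex lists as labellings and isomorphisms

data At {A : Set} : List A → ℕ → A → Set where
  zeroth : ∀ {x xs} → At (x ∷ xs) 0 x
  next   : ∀ {x xs k y} → At xs k y → At (x ∷ xs) (suc k) y

module _ {A : Set} where

  At-∈ : ∀ {xs k} {y : A} → At xs k y → y ∈ xs
  At-∈ zeroth = here refl
  At-∈ (next p) = there (At-∈ p)

  At-unique : ∀ {xs k l} {y : A} → Unique xs → At xs k y → At xs l y → k ≡ l
  At-unique _ zeroth zeroth = refl
  At-unique (x≢ ∷ _) zeroth (next p) = contradiction refl (All.lookup x≢ (At-∈ p))
  At-unique (x≢ ∷ _) (next p) zeroth = contradiction refl (All.lookup x≢ (At-∈ p))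
  At-unique (_ ∷ uniq) (next p) (next r) = cong suc (At-unique uniq p r)

  At-functional : ∀ {xs k} {y z : A} → At xs k y → At xs k z → y ≡ z
  At-functional zeroth zeroth = refl
  At-functional (next p) (next r) = At-functional p r

  At-lookup : (xs : List A) (i : Fin (length xs)) → At xs (toℕ i) (lookup xs i)
  At-lookup (x ∷ xs) Fin.zero = zeroth
  At-lookup (x ∷ xs) (Fin.suc i) = next (At-lookup xs i)

-- A missing vertex could be prepended, giving more than `n` distinct vertices.
covers : ∀ {n} {xs : List (Fin n)} → Unique xs → n ≤ length xs → ∀ u → u ∈ xs
covers {n} {xs} uniq le u with any? (u Fin.≟_) xs
... | yes u∈xs = u∈xs
... | no u∉xs = contradiction le (<⇒≱ (≤-trans
    (length-⊆ (All.tabulate (λ { v∈xs refl → u∉xs v∈xs }) ∷ uniq) λ _ → ∈-allFin _)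
    (≤-reflexive (FinSums.length-V n))))

module Enumeration {n : ℕ} {L : List (Fin n)} (L-unique : Unique L) (L-length : length L ≡ n) where

  open FinSums n

  private
    ∈L : ∀ u → u ∈ L
    ∈L = covers L-unique (≤-reflexive (sym L-length))

  position : Fin n → Fin n
  position u = Fin.cast L-length (Any.index (∈L u))

  private
    element : Fin n → Fin n
    element i = lookup L (Fin.cast (sym L-length) i)

  At-position : ∀ u → At L (toℕ (position u)) u
  At-position u = subst₂ (At L) (sym (Fin.toℕ-cast L-length (Any.index (∈L u))))
    (sym (lookup-index (∈L u))) (At-lookup L (Any.index (∈L u)))

  private
    At-element : ∀ i → At L (toℕ i) (element i)
    At-element i = subst (λ k → At L k (element i)) (Fin.toℕ-cast (sym L-length) i)
      (At-lookup L (Fin.cast (sym L-length) i))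

  -- Sends a vertex to its position in `L`, so that an isomorphism onto a digraph on numbers is
  -- given by listing the vertices in the order of their labels.
  enumeration : Permutation′ n
  enumeration = permutation position element
    (λ i → Fin.toℕ-injective (At-unique L-unique (At-position (element i)) (At-element i)))
    (λ u → At-functional (At-element (position u)) (At-position u))

  isoTo : {D : Digraph n} (E : ℕ → ℕ → Bool) →
    (∀ {i j u v} → At L i u → At L j v → D u v ≡ E i j) → IsoTo D E
  isoTo E eq = enumeration , λ u v → eq (At-position u) (At-position v)

-- A strict inequality at one entry could not be made up for by the others. Applied to arc
-- indicators, this turns a bijection that preserves arcs in one direction into an isomorphism.
∑-tight : {A : Set} (xs : List A) {f g : A → ℕ} → (∀ x → f x ≤ g x) → ∑ xs g ≤ ∑ xs f →
  ∀ {x} → x ∈ xs → f x ≡ g x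
∑-tight (y ∷ xs) {f} {g} f≤g le (here refl) = ≤-antisym (f≤g y)
  (+-cancelʳ-≤ (∑ xs f) (g y) (f y) (≤-trans (+-monoʳ-≤ (g y) (∑-mono xs f≤g)) le))
∑-tight (y ∷ xs) {f} {g} f≤g le (there x∈xs) = ∑-tight xs f≤g
  (+-cancelˡ-≤ (f y) (∑ xs g) (∑ xs f) (≤-trans (+-monoˡ-≤ (∑ xs g) (f≤g y)) le)) x∈xs

χ-mono : ∀ {b c} → (b ≡ true → c ≡ true) → χ b ≤ χ c
χ-mono {false} _ = z≤n
χ-mono {true} imp rewrite imp refl = ≤-refl

χ-injective : ∀ {b c} → χ b ≡ χ c → b ≡ c
χ-injective {false} {false} _ = refl
χ-injective {true} {true} _ = refl

module Structure {m : ℕ} {D : Digraph (2 * m)} (X : MatchedOrientation m D) where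

  open Counting X public

  -- Preserving the arcs of E suffices, because D has no more arcs than E.
  isoTo-by-count : (E : ℕ → ℕ → Bool) {L : List (Fin n)} → Unique L → length L ≡ n →
    n ≤ ∑₂ (λ i j → χ (E (toℕ i) (toℕ j))) →
    (∀ {i j u v} → At L i u → At L j v → E i j ≡ true → u ⟶ v) → IsoTo D E
  isoTo-by-count E uniq len n≤E preserves = enumeration , λ u v →
    sym (χ-injective (∑-tight V² (λ (u , v) → χ-mono (preserves (At-position u) (At-position v)))
      total (∈-V² {u , v})))
    where
    open Enumeration uniq len
    open ≤-Reasoning
    total : ∑[ e ∈ V² ] χ (D (proj₁ e) (proj₂ e))
      ≤ ∑[ e ∈ V² ] χ (E (toℕ (position (proj₁ e))) (toℕ (position (proj₂ e))))
    total = begin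
      ∑[ e ∈ V² ] χ (D (proj₁ e) (proj₂ e))
        ≡⟨ trans (∑V² (λ u v → χ (D u v))) arc-count ⟩
      n
        ≤⟨ n≤E ⟩
      ∑₂ (λ i j → χ (E (toℕ i) (toℕ j)))
        ≡⟨ sym (∑-permute enumeration (λ i → ∑[ j ∈ V ] χ (E (toℕ i) (toℕ j)))) ⟩
      ∑₂ (λ u j → χ (E (toℕ (position u)) (toℕ j)))
        ≡⟨ sym (∑-cong V λ u → ∑-permute enumeration (λ j → χ (E (toℕ (position u)) (toℕ j)))) ⟩
      ∑₂ (λ u v → χ (E (toℕ (position u)) (toℕ (position v))))
        ≡⟨ sym (∑V² (λ u v → χ (E (toℕ (position u)) (toℕ (position v))))) ⟩
      ∑[ e ∈ V² ] χ (E (toℕ (position (proj₁ e))) (toℕ (position (proj₂ e)))) ∎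

  -- Lower bounds for `Δ` and `Λ`

  ∑V²-≥ : (f : Fin n → Fin n → ℕ) {es : List (Fin n × Fin n)} → Unique es →
    ∑[ e ∈ es ] f (proj₁ e) (proj₂ e) ≤ ∑₂ f
  ∑V²-≥ f uniq = ≤-trans (∑-support _ uniq λ _ _ → ∈-V²) (≤-reflexive (∑V² f))

  ∑V-≥ : (f : Fin n → ℕ) {us : List (Fin n)} → Unique us → ∑ us f ≤ ∑ V f
  ∑V-≥ f uniq = ∑-support f uniq λ _ _ → ∈-allFin _

  S-≥1 : ∀ {u v x y} → x ⇢ y → ¬ Touch u v x y → 1 ≤ S u v
  S-≥1 {u} {v} {x} {y} x⇢y ¬t = ≤-trans (≤-reflexive (sym eq))
    (∑V²-≥ (λ x y → q x y * apart u v x y) {(x , y) ∷ []} ([] ∷ []))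
    where
    eq : q x y * apart u v x y + 0 ≡ 1
    eq rewrite ⇢⇒q x⇢y | dec-false (touch? u v x y) ¬t = refl

  qS-≥1 : ∀ {u v x y} → u ⇢ v → x ⇢ y → ¬ Touch u v x y → 1 ≤ q u v * S u v
  qS-≥1 u⇢v x⇢y ¬t = *-mono-≤ (≤-reflexive (sym (⇢⇒q u⇢v))) (S-≥1 x⇢y ¬t)

  -- The two disjoint arcs form two ordered pairs, each counted in `Δ`.
  Δ-≥2 : ∀ {u v x y} → u ⇢ v → x ⇢ y → ¬ Touch u v x y → 2 ≤ Δ
  Δ-≥2 {u} {v} {x} {y} u⇢v x⇢y ¬t = ≤-trans
    (+-mono-≤ (qS-≥1 u⇢v x⇢y ¬t) (+-mono-≤ (qS-≥1 x⇢y u⇢v (¬t ∘ Touch-sym)) z≤n))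
    (∑V²-≥ (λ u v → q u v * S u v) {(u , v) ∷ (x , y) ∷ []} ((apart-≢ ¬t ∷ []) ∷ [] ∷ []))

  -- The pair beginning with `s → t` is a third ordered pair, since `s → t` is neither of the first
  -- two arcs; the arc `a → b` may be one of them.
  Δ-≥3 : ∀ {u v x y s t a b} → u ⇢ v → x ⇢ y → ¬ Touch u v x y →
    s ⇢ t → (s , t) ∉ (u , v) ∷ (x , y) ∷ [] → a ⇢ b → ¬ Touch s t a b → 3 ≤ Δ
  Δ-≥3 {u} {v} {x} {y} {s} {t} u⇢v x⇢y ¬t s⇢t ∉uvxy a⇢b ¬t′ = ≤-trans
    (+-mono-≤ (qS-≥1 s⇢t a⇢b ¬t′)
      (+-mono-≤ (qS-≥1 u⇢v x⇢y ¬t) (+-mono-≤ (qS-≥1 x⇢y u⇢v (¬t ∘ Touch-sym)) z≤n)))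
    (∑V²-≥ (λ u v → q u v * S u v) {(s , t) ∷ (u , v) ∷ (x , y) ∷ []}
      ((∉uvxy ∘ here ∷ ∉uvxy ∘ there ∘ here ∷ []) ∷ (apart-≢ ¬t ∷ []) ∷ [] ∷ []))

  Δ≡0⇒Touch : Δ ≡ 0 → ∀ {u v x y} → u ⇢ v → x ⇢ y → Touch u v x y
  Δ≡0⇒Touch Δ≡0 {u} {v} {x} {y} u⇢v x⇢y with touch? u v x y
  ... | yes t = t
  ... | no ¬t = contradiction (≤-trans (Δ-≥2 u⇢v x⇢y ¬t) (≤-reflexive Δ≡0)) λ ()

  *≢0ˡ : ∀ a {b} → a * b ≢ 0 → a ≢ 0
  *≢0ˡ a ab≢0 refl = ab≢0 refl

  *≢0ʳ : ∀ a {b} → a * b ≢ 0 → b ≢ 0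
  *≢0ʳ a ab≢0 refl = ab≢0 (*-zeroʳ a)

  ∑₂-≢0 : (f : Fin n → Fin n → ℕ) → ∑₂ f ≢ 0 → ∃₂ λ u v → f u v ≢ 0
  ∑₂-≢0 f ≢0 = let u , _ , ≢0′ = ∑-≢0 V ≢0 ; v , _ , ≢0″ = ∑-≢0 V ≢0′ in u , v , ≢0″

  Δ≢0⇒apart : Δ ≢ 0 → ∃₂ λ u v → ∃₂ λ x y → u ⇢ v × x ⇢ y × ¬ Touch u v x y
  Δ≢0⇒apart Δ≢0 with ∑₂-≢0 (λ u v → q u v * S u v) Δ≢0
  ... | u , v , qS≢0 with ∑₂-≢0 (λ x y → q x y * apart u v x y) (*≢0ʳ (q u v) qS≢0)
  ...   | x , y , qa≢0 = u , v , x , y , q⇒⇢ (*≢0ˡ (q u v) qS≢0) , q⇒⇢ (*≢0ˡ (q x y) qa≢0) ,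
    λ t → *≢0ʳ (q x y) qa≢0 (cong (χ ∘ not) (dec-true (touch? u v x y) t))

  -- The `m` arcs outside `μ` cannot all lie in a list of fewer than `m` pairs.
  another-arc : (es : List (Fin n × Fin n)) → length es < m → ∃₂ λ u v → u ⇢ v × (u , v) ∉ es
  another-arc es lt
    with (u , v) , q≢0 , ∉es ← ∑-escape (≡-dec _≟_ _≟_) {ys = es} (λ e → q (proj₁ e) (proj₂ e)) V²-unique
      (≤-trans (s≤s (∑-≤length es λ (u , v) → q≤1 u v)) (≤-trans lt (≤-reflexive (sym (trans (∑V² q) ∑q)))))
    = u , v , q⇒⇢ q≢0 , ∉es

  count-≥ : (f : Fin n → Bool) {us : List (Fin n)} → Unique us → All (λ u → f u ≡ true) us →
    length us ≤ ∑[ u ∈ V ] χ (f u)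
  count-≥ f uniq all = ≤-trans (≤-reflexive (sym (ones all))) (∑V-≥ (χ ∘ f) uniq)
    where
    ones : ∀ {us} → All (λ u → f u ≡ true) us → ∑[ u ∈ us ] χ (f u) ≡ length us
    ones [] = refl
    ones (fu ∷ all) = cong₂ _+_ (cong χ fu) (ones all)

  pair-unique : {x y : Fin n} → x ≢ y → Unique (x ∷ y ∷ [])
  pair-unique x≢y = (x≢y ∷ []) ∷ [] ∷ []

  infix 4 _─_ _┄_

  _─_ _┄_ : Fin n → Fin n → Set
  u ─ v = u ⟶ v ⊎ v ⟶ u
  u ┄ v = u ⇢ v ⊎ v ⇢ u

  d⁺d⁻≤Λ : ∀ z → d⁺ z * d⁻ z ≤ Λ
  d⁺d⁻≤Λ z = ≤-trans (≤-reflexive (sym (+-identityʳ _))) (∑V-≥ (λ u → d⁺ u * d⁻ u) {z ∷ []} ([] ∷ []))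

  d⁺-≥ : ∀ {z us} → Unique us → All (z ⟶_) us → length us ≤ d⁺ z
  d⁺-≥ {z} = count-≥ (D z)

  d⁻-≥ : ∀ {z us} → Unique us → All (_⟶ z) us → length us ≤ d⁻ z
  d⁻-≥ {z} = count-≥ (λ u → D u z)

  mixed : ∀ {x y z} → x ⟶ z → z ⟶ y → 1 ≤ d⁺ z * d⁻ z
  mixed x⟶z z⟶y = *-mono-≤ (d⁺-≥ ([] ∷ []) (z⟶y ∷ [])) (d⁻-≥ ([] ∷ []) (x⟶z ∷ []))

  mixed-≥1 : ∀ {x y z} → x ⟶ z → z ⟶ y → 1 ≤ Λ
  mixed-≥1 x⟶z z⟶y = ≤-trans (mixed x⟶z z⟶y) (d⁺d⁻≤Λ _)

  two-mixed-≥2 : ∀ {x y z x′ y′ z′} → z ≢ z′ → x ⟶ z → z ⟶ y → x′ ⟶ z′ → z′ ⟶ y′ → 2 ≤ Λ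
  two-mixed-≥2 {z = z} {z′ = z′} z≢z′ xz zy xz′ zy′ = ≤-trans
    (+-mono-≤ (mixed xz zy) (+-mono-≤ (mixed xz′ zy′) z≤n))
    (∑V-≥ (λ u → d⁺ u * d⁻ u) {z ∷ z′ ∷ []} (pair-unique z≢z′))

  -- The third edge at `z` raises one of its two degrees to at least `2`, whichever way it points.
  branching-≥2 : ∀ {x y z t} → x ⟶ z → z ⟶ y → z ─ t → x ≢ t → y ≢ t → 2 ≤ Λ
  branching-≥2 xz zy (inj₁ zt) _ y≢t = ≤-trans
    (*-mono-≤ (d⁺-≥ (pair-unique y≢t) (zy ∷ zt ∷ [])) (d⁻-≥ ([] ∷ []) (xz ∷ []))) (d⁺d⁻≤Λ _)
  branching-≥2 xz zy (inj₂ tz) x≢t _ = ≤-trans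
    (*-mono-≤ (d⁺-≥ ([] ∷ []) (zy ∷ [])) (d⁻-≥ (pair-unique x≢t) (xz ∷ tz ∷ []))) (d⁺d⁻≤Λ _)

  ┄⇒─ : ∀ {u v} → u ┄ v → u ─ v
  ┄⇒─ (inj₁ (u⟶v , _)) = inj₁ u⟶v
  ┄⇒─ (inj₂ (v⟶u , _)) = inj₂ v⟶u

  ┄⇒≢ : ∀ {u v} → u ┄ v → u ≢ v
  ┄⇒≢ (inj₁ (u⟶v , _)) = ⟶⇒≢ u⟶v
  ┄⇒≢ (inj₂ (v⟶u , _)) = ≢-sym (⟶⇒≢ v⟶u)

  ┄⇒μ≢ : ∀ {u v} → u ┄ v → μ u ≢ v
  ┄⇒μ≢ (inj₁ (_ , ≢v)) = ≢v
  ┄⇒μ≢ (inj₂ (_ , ≢u)) = ≢u ∘ μ-flip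

  -- Sources and sinks cannot alternate around a triangle because three is odd. The relation is a
  -- parameter so as to serve both all arcs and those outside `μ`.
  triangle-mixed : (_~_ : Fin n → Fin n → Set) → ∀ {x y z} →
    x ~ y ⊎ y ~ x → y ~ z ⊎ z ~ y → x ~ z ⊎ z ~ x →
    ∃₂ λ a b → ∃ λ c → a ~ b × b ~ c
  triangle-mixed _ (inj₁ xy) (inj₁ yz) _ = _ , _ , _ , xy , yz
  triangle-mixed _ (inj₁ xy) (inj₂ zy) (inj₁ xz) = _ , _ , _ , xz , zy
  triangle-mixed _ (inj₁ xy) (inj₂ zy) (inj₂ zx) = _ , _ , _ , zx , xy
  triangle-mixed _ (inj₂ yx) (inj₁ yz) (inj₁ xz) = _ , _ , _ , yx , xz
  triangle-mixed _ (inj₂ yx) (inj₁ yz) (inj₂ zx) = _ , _ , _ , yz , zx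
  triangle-mixed _ (inj₂ yx) (inj₂ zy) _ = _ , _ , _ , zy , yx

  triangle-≥1 : ∀ {x y z} → x ─ y → y ─ z → x ─ z → 1 ≤ Λ
  triangle-≥1 xy yz xz = let _ , _ , _ , ab , bc = triangle-mixed _⟶_ xy yz xz in mixed-≥1 ab bc

  -- The matching edge at `b` is a third edge there, so `b` branches.
  unmatched-path-≥2 : ∀ {a b c} → a ⇢ b → b ⇢ c → 2 ≤ Λ
  unmatched-path-≥2 {b = b} a⇢b b⇢c = branching-≥2 (proj₁ a⇢b) (proj₁ b⇢c) (μ-arc b)
    (≢-sym (┄⇒μ≢ (inj₂ a⇢b))) (≢-sym (proj₂ b⇢c))

  unmatched-triangle-≥2 : ∀ {x y z} → x ┄ y → y ┄ z → x ┄ z → 2 ≤ Λ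
  unmatched-triangle-≥2 xy yz xz = let _ , _ , _ , ab , bc = triangle-mixed _⇢_ xy yz xz in unmatched-path-≥2 ab bc

-- Pairwise intersecting arcs outside the matching: triangle or star

module Shape {m : ℕ} {D : Digraph (2 * m)} (X : MatchedOrientation m D) where

  open Structure X public

  infix 4 _⇢?_ _┄?_

  _⇢?_ : ∀ u v → Dec (u ⇢ v)
  u ⇢? v = (D u v Data.Bool.≟ true) ×-dec ¬? (μ u ≟ v)

  _┄?_ : ∀ u v → Dec (u ┄ v)
  u ┄? v = (u ⇢? v) ⊎-dec (v ⇢? u)

  -- Both `leaf` and its partner are joined to the centre, so the matching edge between them closes
  -- a triangle of the graph.
  record Star : Set where
    field
      centre leaf  : Fin n
      spoke        : centre ┄ leaf
      spoke′       : centre ┄ μ leaf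
      through      : ∀ {u v} → u ⇢ v → u ≡ centre ⊎ v ≡ centre

  leaves : Fin n → List (Fin n)
  leaves w = filter (w ┄?_) V

  leaves-unique : ∀ w → Unique (leaves w)
  leaves-unique w = filter⁺ (w ┄?_) (allFin⁺ n)

  ∈-leaves⁺ : ∀ {w x} → w ┄ x → x ∈ leaves w
  ∈-leaves⁺ {w} = ∈-filter⁺ (w ┄?_) (∈-allFin _)

  ∈-leaves⁻ : ∀ {w x} → x ∈ leaves w → w ┄ x
  ∈-leaves⁻ {w} x∈ = proj₂ (∈-filter⁻ (w ┄?_) {xs = V} x∈)

  q+q≤1 : ∀ u v → q u v + q v u ≤ 1
  q+q≤1 u v with u ⇢? v | v ⇢? u
  ... | yes (uv , _) | yes (vu , _) = contradiction vu (asymmetric uv)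
  ... | no ¬uv | _ with q u v in eq
  ...   | zero = q≤1 v u
  ...   | suc _ = contradiction (q⇒⇢ λ q≡0 → contradiction (trans (sym eq) q≡0) λ ()) ¬uv
  q+q≤1 u v | yes _ | no ¬vu with q v u in eq
  ...   | zero = ≤-trans (≤-reflexive (+-identityʳ _)) (q≤1 u v)
  ...   | suc _ = contradiction (q⇒⇢ λ q≡0 → contradiction (trans (sym eq) q≡0) λ ()) ¬vu

  +≢0 : ∀ {a b} → a + b ≢ 0 → a ≢ 0 ⊎ b ≢ 0
  +≢0 {zero} b≢0 = inj₂ b≢0
  +≢0 {suc a} _ = inj₁ λ ()

  -- Every arc outside `μ` has `w` as an end, so `h w` is at least `m`. No leaf is joined to `w` by
  -- two arcs, so `h w` is at most the number of leaves.
  many-leaves : ∀ w → (∀ {u v} → u ⇢ v → u ≡ w ⊎ v ≡ w) → m ≤ length (leaves w)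
  many-leaves w through = begin
    m
      ≡⟨ sym ∑q ⟩
    ∑₂ q
      ≤⟨ ∑-mono V (λ u → ∑-mono V (pointwise u)) ⟩
    ∑₂ (λ u v → q u v * δ w u + q u v * δ w v)
      ≡⟨ trans (∑₂-+ _ _) (cong₂ _+_ (∑₂-δrow q w) (∑₂-δcol q w)) ⟩
    h w
      ≡⟨ sym (∑-+ V _ _) ⟩
    ∑[ x ∈ V ] (q w x + q x w)
      ≤⟨ ∑-support _ (allFin⁺ n) (λ _ ≢0 → ∈-leaves⁺ (Data.Sum.map q⇒⇢ q⇒⇢ (+≢0 ≢0))) ⟩
    ∑[ x ∈ leaves w ] (q w x + q x w)
      ≤⟨ ∑-≤length (leaves w) (q+q≤1 w) ⟩
    length (leaves w) ∎
    where
    open ≤-Reasoning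
    pointwise : ∀ u v → q u v ≤ q u v * δ w u + q u v * δ w v
    pointwise u v with q u v in eq
    ... | zero = z≤n
    ... | suc k with through (q⇒⇢ λ q≡0 → contradiction (trans (sym eq) q≡0) λ ())
    ...   | inj₁ refl rewrite dec-true (u ≟ u) refl =
      ≤-trans (≤-reflexive (sym (*-identityʳ (suc k)))) (m≤m+n _ _)
    ...   | inj₂ refl rewrite dec-true (v ≟ v) refl =
      ≤-trans (≤-reflexive (sym (*-identityʳ (suc k)))) (m≤n+m _ _)

  -- Interleaving vertices with their partners is also the order in which the labels of `Uarc`
  -- alternate between the x_j and the y_j.
  spread : List (Fin n) → List (Fin n)
  spread [] = []
  spread (x ∷ xs) = x ∷ μ x ∷ spread xs

  length-spread : ∀ xs → length (spread xs) ≡ 2 * length xs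
  length-spread [] = refl
  length-spread (x ∷ xs) = trans (cong (2 +_) (length-spread xs)) (sym (*-suc 2 (length xs)))

  ∈-spread⁻ : ∀ {xs y} → y ∈ spread xs → y ∈ xs ⊎ μ y ∈ xs
  ∈-spread⁻ {x ∷ xs} (here refl) = inj₁ (here refl)
  ∈-spread⁻ {x ∷ xs} (there (here refl)) = inj₂ (here (μ-involutive x))
  ∈-spread⁻ {x ∷ xs} (there (there y∈)) = Data.Sum.map there there (∈-spread⁻ y∈)

  spread-unique : ∀ {xs} → Unique xs → (∀ {x} → x ∈ xs → μ x ∉ xs) → Unique (spread xs)
  spread-unique {[]} _ _ = []
  spread-unique {x ∷ xs} (x≢ ∷ uniq) unpaired =
    ((λ x≡μx → unpaired (here refl) (here (sym x≡μx))) ∷ All.tabulate new)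
      ∷ All.tabulate new′
      ∷ spread-unique uniq (λ y∈ μy∈ → unpaired (there y∈) (there μy∈))
    where
    new : ∀ {y} → y ∈ spread xs → x ≢ y
    new y∈ refl with ∈-spread⁻ y∈
    ... | inj₁ x∈ = All.lookup x≢ x∈ refl
    ... | inj₂ μx∈ = unpaired (here refl) (there μx∈)
    new′ : ∀ {y} → y ∈ spread xs → μ x ≢ y
    new′ y∈ refl with ∈-spread⁻ y∈
    ... | inj₁ μx∈ = unpaired (here refl) (there μx∈)
    ... | inj₂ μμx∈ = All.lookup x≢ μμx∈ (sym (μ-involutive x))

  μ-≢ : ∀ u → u ≢ μ u
  μ-≢ u u≡μu with μ-arc u
  ... | inj₁ u⟶ = ⟶⇒≢ u⟶ u≡μu
  ... | inj₂ ⟶u = ⟶⇒≢ ⟶u (sym u≡μu)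

  touch-┄ : Δ ≡ 0 → ∀ {u v x y} → u ┄ v → x ⇢ y → Touch u v x y
  touch-┄ Δ≡0 (inj₁ u⇢v) x⇢y = Δ≡0⇒Touch Δ≡0 u⇢v x⇢y
  touch-┄ Δ≡0 (inj₂ v⇢u) x⇢y = swap (Δ≡0⇒Touch Δ≡0 v⇢u x⇢y)

  UnmatchedTriangle : Set
  UnmatchedTriangle = ∃₂ λ x y → ∃ λ z → x ┄ y × y ┄ z × x ┄ z

  -- Two distinct arcs outside `μ` meet in a vertex `w`. They are not reverse to each other either,
  -- so their other ends differ.
  fan : 2 ≤ m → Δ ≡ 0 → ∃₂ λ w a → ∃ λ b → w ┄ a × w ┄ b × a ≢ b
  fan 2≤m Δ≡0 with another-arc [] (≤-trans (s≤s z≤n) 2≤m)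
  ... | u , v , u⇢v , _ with another-arc ((u , v) ∷ []) 2≤m
  ...   | x , y , x⇢y , ∉uv with Δ≡0⇒Touch Δ≡0 u⇢v x⇢y
  ...     | inj₁ (inj₁ refl) = u , v , y , inj₁ u⇢v , inj₁ x⇢y , λ { refl → ∉uv (here refl) }
  ...     | inj₁ (inj₂ refl) = u , v , x , inj₁ u⇢v , inj₂ x⇢y , λ { refl → asymmetric (proj₁ u⇢v) (proj₁ x⇢y) }
  ...     | inj₂ (inj₁ refl) = v , u , y , inj₂ u⇢v , inj₁ x⇢y , λ { refl → asymmetric (proj₁ u⇢v) (proj₁ x⇢y) }
  ...     | inj₂ (inj₂ refl) = v , u , x , inj₂ u⇢v , inj₂ x⇢y , λ { refl → ∉uv (here refl) }

  -- Otherwise `w`, `μ w`, the leaves and the partners of the leaves are all distinct, which makes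
  -- at least `2 + 2 * m` vertices.
  double-spoke : ∀ w → (∀ {u v} → u ⇢ v → u ≡ w ⊎ v ≡ w) → ∃ λ a → w ┄ a × w ┄ μ a
  double-spoke w through with Fin.any? (λ a → (w ┄? a) ×-dec (w ┄? μ a))
  ... | yes found = found
  ... | no none = contradiction too-long (<⇒≱
    (≤-trans (s≤s (n≤1+n n)) (s≤s (s≤s (*-monoʳ-≤ 2 (many-leaves w through))))))
    where
    unique : Unique (w ∷ μ w ∷ spread (leaves w))
    unique = (μ-≢ w ∷ All.tabulate new) ∷ All.tabulate new′ ∷ spread-unique (leaves-unique w)
      (λ x∈ μx∈ → none (_ , ∈-leaves⁻ x∈ , ∈-leaves⁻ μx∈))
      where
      new : ∀ {y} → y ∈ spread (leaves w) → w ≢ y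
      new y∈ refl with ∈-spread⁻ y∈
      ... | inj₁ w∈ = ┄⇒≢ (∈-leaves⁻ w∈) refl
      ... | inj₂ μw∈ = ┄⇒μ≢ (∈-leaves⁻ μw∈) refl
      new′ : ∀ {y} → y ∈ spread (leaves w) → μ w ≢ y
      new′ y∈ refl with ∈-spread⁻ y∈
      ... | inj₁ μw∈ = ┄⇒μ≢ (∈-leaves⁻ μw∈) refl
      ... | inj₂ μμw∈ = ┄⇒≢ (∈-leaves⁻ μμw∈) (sym (μ-involutive w))
    too-long : 2 + 2 * length (leaves w) ≤ n
    too-long = ≤-trans (≤-reflexive (cong (2 +_) (sym (length-spread (leaves w)))))
      (≤-trans (length-⊆ unique (λ _ → ∈-allFin _)) (≤-reflexive length-V))

  -- A graph with pairwise intersecting edges is a triangle or a star. The star has m edges but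
  -- only m − 1 matching edges avoid its centre, so two of its leaves are matched to each other.
  shape : 2 ≤ m → Δ ≡ 0 → UnmatchedTriangle ⊎ Star
  shape 2≤m Δ≡0 = let w , _ , _ , wa , wb , a≢b = fan 2≤m Δ≡0 in from-fan wa wb a≢b (avoiding? w)
    where
    Avoiding : Fin n → Set
    Avoiding w = ∃₂ λ u v → u ⇢ v × u ≢ w × v ≢ w

    avoiding? : ∀ w → Dec (Avoiding w)
    avoiding? w = Fin.any? λ u → Fin.any? λ v → (u ⇢? v) ×-dec (¬? (u ≟ w) ×-dec ¬? (v ≟ w))

    from-fan : ∀ {w a b} → w ┄ a → w ┄ b → a ≢ b → Dec (Avoiding w) → UnmatchedTriangle ⊎ Star
    -- The arc `u → v` avoids `w` but meets both spokes, so it joins `a` and `b`.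
    from-fan {w} {a} {b} wa wb a≢b (yes (u , v , u⇢v , u≢w , v≢w)) =
      inj₁ (w , a , b , wa , ab (outer wa) (outer wb) , wb)
      where
      outer : ∀ {x} → w ┄ x → x ≡ u ⊎ x ≡ v
      outer wx with touch-┄ Δ≡0 wx u⇢v
      ... | inj₁ (inj₁ w≡u) = contradiction (sym w≡u) u≢w
      ... | inj₁ (inj₂ w≡v) = contradiction (sym w≡v) v≢w
      ... | inj₂ x≡ = x≡
      ab : a ≡ u ⊎ a ≡ v → b ≡ u ⊎ b ≡ v → a ┄ b
      ab (inj₁ refl) (inj₁ refl) = contradiction refl a≢b
      ab (inj₁ refl) (inj₂ refl) = inj₁ u⇢v
      ab (inj₂ refl) (inj₁ refl) = inj₂ u⇢v
      ab (inj₂ refl) (inj₂ refl) = contradiction refl a≢b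
    from-fan {w} _ _ _ (no none) = let c , wc , wμc = double-spoke w through in
      inj₂ (record { centre = w ; leaf = c ; spoke = wc ; spoke′ = wμc ; through = through })
      where
      through : ∀ {u v} → u ⇢ v → u ≡ w ⊎ v ≡ w
      through {u} {v} u⇢v with u ≟ w | v ≟ w
      ... | yes u≡w | _ = inj₁ u≡w
      ... | _ | yes v≡w = inj₂ v≡w
      ... | no u≢w | no v≢w = contradiction (u , v , u⇢v , u≢w , v≢w) none

  shape-≥1 : UnmatchedTriangle ⊎ Star → 1 ≤ Λ
  shape-≥1 (inj₁ (_ , _ , _ , xy , yz , xz)) = triangle-≥1 (┄⇒─ xy) (┄⇒─ yz) (┄⇒─ xz)
  shape-≥1 (inj₂ star) = triangle-≥1 (┄⇒─ spoke) (μ-arc leaf) (┄⇒─ spoke′)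
    where open Star star

  defect-≥2 : 2 ≤ m → 2 ≤ 2 * Λ + Δ
  defect-≥2 2≤m with Δ Data.Nat.≟ 0
  ... | yes Δ≡0 = ≤-trans (*-monoʳ-≤ 2 (shape-≥1 (shape 2≤m Δ≡0))) (m≤m+n _ _)
  ... | no Δ≢0 = let _ , _ , _ , _ , u⇢v , x⇢y , ¬t = Δ≢0⇒apart Δ≢0 in
    ≤-trans (Δ-≥2 u⇢v x⇢y ¬t) (m≤n+m _ _)

-- Reading arcs off the boolean description of U_{2m,m}

∧-true : ∀ {b c} → b ∧ c ≡ true → b ≡ true × c ≡ true
∧-true {true} {true} _ = refl , refl

∨-true : ∀ {b c} → b ∨ c ≡ true → b ≡ true ⊎ c ≡ true
∨-true {true} _ = inj₁ refl
∨-true {false} eq = inj₂ eq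

true⇒T : ∀ {b} → b ≡ true → T b
true⇒T refl = _

iff⇒≡ : ∀ {b c} → (b ≡ true → c ≡ true) → (c ≡ true → b ≡ true) → b ≡ c
iff⇒≡ {true} b⇒c _ = sym (b⇒c refl)
iff⇒≡ {false} {false} _ _ = refl
iff⇒≡ {false} {true} _ c⇒b = c⇒b refl

evenᵇ-2+ : ∀ k → evenᵇ (2 + k) ≡ evenᵇ k
evenᵇ-2+ k = not-involutive (evenᵇ k)

odd-suc : ∀ k → evenᵇ k ≡ true → evenᵇ (suc k) ≢ true
odd-suc k even odd rewrite even = contradiction odd λ ()

≡ᵇ-refl : ∀ k → (k ≡ᵇ k) ≡ true
≡ᵇ-refl zero = refl
≡ᵇ-refl (suc k) = ≡ᵇ-refl k

-- The inductive form of `Uarc`, which lets arcs be analysed by pattern matching. In `inward` the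
-- even number `k` is `2 * j`, and the arc is y_j → x_j.
data UArc : Bool → ℕ → ℕ → Set where
  spoke   : ∀ {ab v} → nbrW v ≡ true → UArc ab 0 v
  inward  : ∀ {ab k} → evenᵇ k ≡ true → UArc ab (5 + k) (4 + k)
  chord   : UArc true 1 2
  chord′  : UArc false 2 1

Uarc⇒UArc : ∀ ab i j → Uarc ab i j ≡ true → UArc ab i j
Uarc⇒UArc ab i j eq with ∨-true {(i ≡ᵇ 0) ∧ nbrW j} eq
... | inj₁ sp with ∧-true {i ≡ᵇ 0} sp
...   | i≡0 , nb with refl ← ≡ᵇ⇒≡ i 0 (true⇒T i≡0) = spoke nb
Uarc⇒UArc ab i j eq | inj₂ rest with ∨-true {yx i j} rest
... | inj₁ arc with ∧-true {i ≡ᵇ suc j} arc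
...   | i≡ , arc′ with ∧-true {4 Data.Nat.≤ᵇ j} arc′
...     | 4≤j , even with refl ← ≡ᵇ⇒≡ i (suc j) (true⇒T i≡) = from-4 j (≤ᵇ⇒≤ 4 j (true⇒T 4≤j)) even
  where
  from-4 : ∀ j → 4 ≤ j → evenᵇ j ≡ true → UArc ab (suc j) j
  from-4 (suc (suc (suc (suc k)))) (s≤s (s≤s (s≤s (s≤s _)))) even =
    inward (trans (sym (trans (evenᵇ-2+ (2 + k)) (evenᵇ-2+ k))) even)
Uarc⇒UArc true i j eq | inj₂ rest | inj₂ ch with ∧-true {i ≡ᵇ 1} ch
... | i≡1 , j≡2 with refl ← ≡ᵇ⇒≡ i 1 (true⇒T i≡1) | refl ← ≡ᵇ⇒≡ j 2 (true⇒T j≡2) = chord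
Uarc⇒UArc false i j eq | inj₂ rest | inj₂ ch with ∧-true {i ≡ᵇ 2} ch
... | i≡2 , j≡1 with refl ← ≡ᵇ⇒≡ i 2 (true⇒T i≡2) | refl ← ≡ᵇ⇒≡ j 1 (true⇒T j≡1) = chord′

Uarc-inward : ∀ ab k → evenᵇ k ≡ true → Uarc ab (5 + k) (4 + k) ≡ true
Uarc-inward ab k even rewrite ≡ᵇ-refl k | even = refl

Uarc-spoke : ∀ ab v → nbrW v ≡ true → Uarc ab 0 v ≡ true
Uarc-spoke ab v nb rewrite nb = refl

-- The star case: recovering U_{2m,m}

module SourceStar {m : ℕ} {D : Digraph (2 * m)} (X : MatchedOrientation m D) where

  open Shape X public

  -- The parity of a position separates the middle vertices x_j from the ends y_j, as `evenᵇ` does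
  -- in `Uarc`.
  data SpreadPlace (xs : List (Fin n)) : ℕ → Fin n → Set where
    middle : ∀ {k x} → evenᵇ k ≡ true → x ∈ xs → SpreadPlace xs k x
    end    : ∀ {k x} → evenᵇ k ≡ true → x ∈ xs → At (spread xs) k x → SpreadPlace xs (suc k) (μ x)

  spread-place : ∀ {xs k y} → At (spread xs) k y → SpreadPlace xs k y
  spread-place {x ∷ xs} zeroth = middle refl (here refl)
  spread-place {x ∷ xs} (next zeroth) = end refl (here refl) zeroth
  spread-place {x ∷ xs} (next (next p)) with spread-place {xs} p
  ... | middle {k} even y∈ = middle (trans (evenᵇ-2+ k) even) (there y∈)
  ... | end {k} even x∈ at = end (trans (evenᵇ-2+ k) even) (there x∈) (next (next at))

  module _ (Λ≤1 : Λ ≤ 1) {w a : Fin n} (from-w : ∀ {u v} → u ⇢ v → u ≡ w) (source : ∀ {u} → ¬ u ⟶ w)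
    (w⇢a : w ⇢ a) (w⇢μa : w ⇢ μ a) (a⟶μa : a ⟶ μ a) where

    private
      -- The vertex `a`, lying on `w → a → μ a`, already uses the single unit allowed to `Λ`, so
      -- every other vertex is a source or a sink.
      unmixed : ∀ {x y z} → z ≢ a → x ⟶ z → ¬ z ⟶ y
      unmixed z≢a xz zy = contradiction Λ≤1
        (<⇒≱ (two-mixed-≥2 (≢-sym z≢a) (proj₁ w⇢a) a⟶μa xz zy))

      other? : ∀ x → Dec (x ≢ a × x ≢ μ a)
      other? x = ¬? (x ≟ a) ×-dec ¬? (x ≟ μ a)

      xs : List (Fin n)
      xs = filter other? (leaves w)

      spoke-from : ∀ {x} → w ┄ x → w ⇢ x
      spoke-from (inj₁ w⇢x) = w⇢x
      spoke-from (inj₂ (x⟶w , _)) = contradiction x⟶w source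

      xs-spoke : ∀ {x} → x ∈ xs → w ⇢ x
      xs-spoke x∈ = spoke-from (∈-leaves⁻ (proj₁ (∈-filter⁻ other? {xs = leaves w} x∈)))

      xs-other : ∀ {x} → x ∈ xs → x ≢ a × x ≢ μ a
      xs-other x∈ = proj₂ (∈-filter⁻ other? {xs = leaves w} x∈)

      -- The spoke from `w` enters `x`, so its matching arc must enter it too.
      xs-inward : ∀ {x} → x ∈ xs → μ x ⟶ x
      xs-inward {x} x∈ with μ-arc x
      ... | inj₁ x⟶μx = contradiction x⟶μx (unmixed (proj₁ (xs-other x∈)) (proj₁ (xs-spoke x∈)))
      ... | inj₂ μx⟶x = μx⟶x

      -- Otherwise `μ x` would be entered from `w` and left towards `x`.
      xs-unpaired : ∀ {x} → x ∈ xs → ¬ w ⇢ μ x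
      xs-unpaired x∈ w⇢μx = unmixed (proj₂ (xs-other x∈) ∘ sym ∘ μ-flip) (proj₁ w⇢μx) (xs-inward x∈)

      -- The order of the labels of `Uarc`: centre, the other two triangle vertices, the pendent
      -- vertex `μ w`, then the pairs x_j, y_j.
      L : List (Fin n)
      L = w ∷ a ∷ μ a ∷ μ w ∷ spread xs

      ⇢⇒≢ : ∀ {u v} → u ⇢ v → u ≢ v
      ⇢⇒≢ (uv , _) = ⟶⇒≢ uv

      L-unique : Unique L
      L-unique =
        (⇢⇒≢ w⇢a ∷ ⇢⇒≢ w⇢μa ∷ μ-≢ w ∷ off (λ x∈ → ⇢⇒≢ (xs-spoke x∈)) (λ x∈ → proj₂ (xs-spoke x∈)))
        ∷ (μ-≢ a ∷ ≢-sym (proj₂ w⇢a)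
            ∷ off (λ x∈ → ≢-sym (proj₁ (xs-other x∈))) (λ x∈ → ≢-sym (proj₂ (xs-other x∈))))
        ∷ (≢-sym (proj₂ w⇢μa)
            ∷ off (λ x∈ → ≢-sym (proj₂ (xs-other x∈)))
                  (λ x∈ eq → proj₁ (xs-other x∈) (trans (sym eq) (μ-involutive a))))
        ∷ off (λ x∈ → proj₂ (xs-spoke x∈)) (λ x∈ eq → ⇢⇒≢ (xs-spoke x∈) (trans (sym (μ-involutive w)) eq))
        ∷ spread-unique (filter⁺ other? (leaves-unique w)) (λ x∈ μx∈ → xs-unpaired x∈ (xs-spoke μx∈))
        where
        off : ∀ {u} → (∀ {x} → x ∈ xs → u ≢ x) → (∀ {x} → x ∈ xs → μ u ≢ x) → All (u ≢_) (spread xs)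
        off {u} ≢x μ≢x = All.tabulate λ y∈ u≡y → excluded u≡y (∈-spread⁻ y∈)
          where
          excluded : ∀ {y} → u ≡ y → ¬ (y ∈ xs ⊎ μ y ∈ xs)
          excluded refl (inj₁ u∈) = ≢x u∈ refl
          excluded refl (inj₂ μu∈) = μ≢x μu∈ refl

      -- There are at least `m` leaves, and all except `a` and `μ a` are in `xs`, so `L` has at
      -- least `n` entries.
      L-length : length L ≡ n
      L-length = ≤-antisym (≤-trans (length-⊆ L-unique (λ _ → ∈-allFin _)) (≤-reflexive length-V)) (begin
        n                             ≤⟨ *-monoʳ-≤ 2 (≤-trans (many-leaves w (inj₁ ∘ from-w)) few) ⟩
        2 * (2 + length xs)           ≡⟨ *-distribˡ-+ 2 2 (length xs) ⟩
        4 + 2 * length xs             ≡⟨ cong (4 +_) (sym (length-spread xs)) ⟩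
        length L                      ∎)
        where
        open ≤-Reasoning
        classify : ∀ {x} → x ∈ leaves w → x ∈ a ∷ μ a ∷ xs
        classify {x} x∈ with x ≟ a | x ≟ μ a
        ... | yes x≡a | _ = here x≡a
        ... | no _ | yes x≡μa = there (here x≡μa)
        ... | no x≢a | no x≢μa = there (there (∈-filter⁺ other? x∈ (x≢a , x≢μa)))
        few : length (leaves w) ≤ 2 + length xs
        few = length-⊆ (leaves-unique w) classify

      matched : ∀ {u v} → u ⟶ v → u ≢ w → μ u ≡ v
      matched {u} {v} u⟶v u≢w with μ u ≟ v
      ... | yes eq = eq
      ... | no ≢v = contradiction (from-w (u⟶v , ≢v)) u≢w

      w⟶μw : w ⟶ μ w
      w⟶μw with μ-arc w
      ... | inj₁ w⟶ = w⟶
      ... | inj₂ ⟶w = contradiction ⟶w source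

      L-spoke : ∀ {j v} → At L j v → w ⟶ v → nbrW j ≡ true
      L-spoke zeroth w⟶w = contradiction w⟶w source
      L-spoke (next zeroth) _ = refl
      L-spoke (next (next zeroth)) _ = refl
      L-spoke (next (next (next zeroth))) _ = refl
      L-spoke (next (next (next (next p)))) w⟶v with spread-place p
      ... | middle even _ = even
      ... | end _ x∈ _ = contradiction (w⟶v , λ eq → ⇢⇒≢ (xs-spoke x∈) (μ-injective eq)) (xs-unpaired x∈)

      L-matched : ∀ {i j u} → At L i u → At L j (μ u) → u ≢ w → u ⟶ μ u → Uarc true i j ≡ true
      L-matched zeroth _ u≢w _ = contradiction refl u≢w
      L-matched (next zeroth) r _ _ with refl ← At-unique L-unique r (next (next zeroth)) = refl
      L-matched (next (next zeroth)) _ _ μa⟶ =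
        contradiction (subst (μ a ⟶_) (μ-involutive a) μa⟶) (asymmetric a⟶μa)
      L-matched (next (next (next zeroth))) _ _ μw⟶ =
        contradiction (subst (μ w ⟶_) (μ-involutive w) μw⟶) source
      L-matched (next (next (next (next p)))) r _ u⟶μu with spread-place p
      ... | middle _ x∈ = contradiction u⟶μu (asymmetric (xs-inward x∈))
      ... | end {k} {x} even _ at
        with refl ← At-unique L-unique r
          (next (next (next (next (subst (At (spread xs) k) (sym (μ-involutive x)) at)))))
        = Uarc-inward true k even

      L-arc : ∀ {i j u v} → At L i u → At L j v → u ⟶ v → Uarc true i j ≡ true
      L-arc {j = j} {u = u} p r u⟶v with u ≟ w
      ... | no u≢w with refl ← matched u⟶v u≢w = L-matched p r u≢w u⟶v
      ... | yes refl with refl ← At-unique L-unique p zeroth = Uarc-spoke true j (L-spoke r u⟶v)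

      L-spoke⁻ : ∀ {j v} → At L j v → nbrW j ≡ true → w ⟶ v
      L-spoke⁻ zeroth ()
      L-spoke⁻ (next zeroth) _ = proj₁ w⇢a
      L-spoke⁻ (next (next zeroth)) _ = proj₁ w⇢μa
      L-spoke⁻ (next (next (next zeroth))) _ = w⟶μw
      L-spoke⁻ (next (next (next (next p)))) nb with spread-place p
      ... | middle _ x∈ = proj₁ (xs-spoke x∈)
      ... | end {k} even _ _ = contradiction nb (odd-suc k even)

      L-arc⁻ : ∀ {i j u v} → At L i u → At L j v → UArc true i j → u ⟶ v
      L-arc⁻ zeroth r (spoke nb) = L-spoke⁻ r nb
      L-arc⁻ (next (next (next (next p)))) r (inward {k = k} even) with spread-place p
      ... | middle odd _ = contradiction odd (odd-suc k even)
      ... | end _ x∈ at with refl ← At-functional r (next (next (next (next at)))) = xs-inward x∈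
      L-arc⁻ (next zeroth) (next (next zeroth)) chord = a⟶μa

    source-star : IsoTo D (Uarc true)
    source-star = Enumeration.isoTo L-unique L-length (Uarc true) λ {i} {j} p r →
      iff⇒≡ (L-arc p r) (L-arc⁻ p r ∘ Uarc⇒UArc true i j)

  -- The two spokes to `a` and `μ a` leave no room for an arc into `w`. The direction of the chord
  -- is absorbed by choosing which of `a` and `μ a` gets label `1`, so `Uarc true` is the only
  -- outcome.
  star-out : Λ ≤ 1 → ∀ {w a} → (∀ {u v} → u ⇢ v → u ≡ w ⊎ v ≡ w) → w ⇢ a → w ┄ μ a → IsoTo D (Uarc true)
  star-out Λ≤1 {w} {a} through w⇢a (inj₂ μa⇢w) =
    contradiction Λ≤1 (<⇒≱ (unmatched-path-≥2 μa⇢w w⇢a))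
  star-out Λ≤1 {w} {a} through w⇢a (inj₁ w⇢μa) = orient (μ-arc a)
    where
    source : ∀ {u} → ¬ u ⟶ w
    source u⟶w = contradiction Λ≤1 (<⇒≱ (branching-≥2 u⟶w (proj₁ w⇢a) (inj₁ (proj₁ w⇢μa))
      (λ { refl → asymmetric u⟶w (proj₁ w⇢μa) }) (μ-≢ a)))

    from-w : ∀ {u v} → u ⇢ v → u ≡ w
    from-w u⇢v with through u⇢v
    ... | inj₁ u≡w = u≡w
    ... | inj₂ refl = contradiction (proj₁ u⇢v) source

    orient : a ─ μ a → IsoTo D (Uarc true)
    orient (inj₁ a⟶μa) = source-star Λ≤1 from-w source w⇢a w⇢μa a⟶μa
    orient (inj₂ μa⟶a) = source-star Λ≤1 from-w source w⇢μa
      (subst (w ⇢_) (sym (μ-involutive a)) w⇢a) (subst (μ a ⟶_) (sym (μ-involutive a)) μa⟶a)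

flip-isoTo : ∀ {n} {D : Digraph n} E → IsoTo (flip D) E → IsoTo D (rev E)
flip-isoTo E (σ , eq) = σ , λ u v → eq v u

-- Two disjoint arcs outside the matching

module Apart {m : ℕ} {D : Digraph (2 * m)} (X : MatchedOrientation m D) where

  open Shape X public

  Unmixed : Set
  Unmixed = ∀ {x y z} → x ⟶ z → ¬ z ⟶ y

  module _ (unmixed : Unmixed) where

    -- When every vertex is a source or a sink, the head of one arc is never the tail of another.
    touch-ends : ∀ {s t a b} → s ⇢ t → a ⇢ b → Touch s t a b → s ≡ a ⊎ t ≡ b
    touch-ends _ _ (inj₁ (inj₁ s≡a)) = inj₁ s≡a
    touch-ends (st , _) (ab , _) (inj₁ (inj₂ refl)) = contradiction st (unmixed ab)
    touch-ends (st , _) (ab , _) (inj₂ (inj₁ refl)) = contradiction ab (unmixed st)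
    touch-ends _ _ (inj₂ (inj₂ t≡b)) = inj₂ t≡b

    source-matched : ∀ {u v} → u ⟶ v → u ⟶ μ u
    source-matched {u} uv with μ-arc u
    ... | inj₁ u⟶μu = u⟶μu
    ... | inj₂ μu⟶u = contradiction uv (unmixed μu⟶u)

    sink-matched : ∀ {u v} → u ⟶ v → μ v ⟶ v
    sink-matched {v = v} uv with μ-arc v
    ... | inj₁ v⟶μv = contradiction v⟶μv (unmixed uv)
    ... | inj₂ μv⟶v = μv⟶v

    module _ {u v x y : Fin n} (u⇢v : u ⇢ v) (x⇢y : x ⇢ y) (¬t : ¬ Touch u v x y) where

      private
        u≢x : u ≢ x
        u≢x = ¬t ∘ inj₁ ∘ inj₁
        u≢y : u ≢ y
        u≢y = ¬t ∘ inj₁ ∘ inj₂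
        v≢x : v ≢ x
        v≢x = ¬t ∘ inj₂ ∘ inj₁
        v≢y : v ≢ y
        v≢y = ¬t ∘ inj₂ ∘ inj₂
        u≢v : u ≢ v
        u≢v = ⟶⇒≢ (proj₁ u⇢v)
        x≢y : x ≢ y
        x≢y = ⟶⇒≢ (proj₁ x⇢y)
        u⟶μu : u ⟶ μ u
        u⟶μu = source-matched (proj₁ u⇢v)
        x⟶μx : x ⟶ μ x
        x⟶μx = source-matched (proj₁ x⇢y)

      -- The arcs `u → v` and `x → y` lie outside `μ` and two sources are not adjacent, so `μ` pairs
      -- `u` with `y` and `x` with `v`, closing the cycle `u v x y`.
      four-vertices : 4 ≡ n → n ≤ ∑₂ (λ i j → χ (c4ss (toℕ i) (toℕ j))) → IsoTo D c4ss
      four-vertices 4≡n count = isoTo-by-count c4ss unique 4≡n count arcs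
        where
        unique : Unique (u ∷ v ∷ x ∷ y ∷ [])
        unique = (u≢v ∷ u≢x ∷ u≢y ∷ []) ∷ (v≢x ∷ v≢y ∷ []) ∷ (x≢y ∷ []) ∷ [] ∷ []
        covered : ∀ z → z ∈ u ∷ v ∷ x ∷ y ∷ []
        covered = covers unique (≤-reflexive (sym 4≡n))
        μu≡y : μ u ≡ y
        μu≡y with covered (μ u)
        ... | here eq = contradiction (sym eq) (μ-≢ u)
        ... | there (here eq) = contradiction eq (proj₂ u⇢v)
        ... | there (there (here eq)) = contradiction (proj₁ x⇢y) (unmixed (subst (u ⟶_) eq u⟶μu))
        ... | there (there (there (here eq))) = eq
        μx≡v : μ x ≡ v
        μx≡v with covered (μ x)
        ... | here eq = contradiction (proj₁ u⇢v) (unmixed (subst (x ⟶_) eq x⟶μx))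
        ... | there (here eq) = eq
        ... | there (there (here eq)) = contradiction (sym eq) (μ-≢ x)
        ... | there (there (there (here eq))) = contradiction eq (proj₂ x⇢y)
        arcs : ∀ {i j a b} → At (u ∷ v ∷ x ∷ y ∷ []) i a → At (u ∷ v ∷ x ∷ y ∷ []) j b →
          c4ss i j ≡ true → a ⟶ b
        arcs zeroth (next zeroth) _ = proj₁ u⇢v
        arcs zeroth (next (next (next zeroth))) _ = subst (u ⟶_) μu≡y u⟶μu
        arcs (next (next zeroth)) (next zeroth) _ = subst (x ⟶_) μx≡v x⟶μx
        arcs (next (next zeroth)) (next (next (next zeroth))) _ = proj₁ x⇢y

      module _ (u⇢y : u ⇢ y) where

        -- The partners of `u` and `y` are new vertices, which leaves only `v` as partner of `x`.
        -- The cycle is `u y x v`, with pendent vertices `μ u` and `μ y`.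
        six-vertices : 6 ≡ n → n ≤ ∑₂ (λ i j → χ (c4ppss (toℕ i) (toℕ j))) → IsoTo D c4ppss
        six-vertices 6≡n count = isoTo-by-count c4ppss unique 6≡n count arcs
          where
          L : List (Fin n)
          L = u ∷ y ∷ x ∷ v ∷ μ u ∷ μ y ∷ []
          μy⟶y : μ y ⟶ y
          μy⟶y = sink-matched (proj₁ x⇢y)
          x≢μu : x ≢ μ u
          x≢μu eq = unmixed (subst (u ⟶_) (sym eq) u⟶μu) (proj₁ x⇢y)
          v≢μy : v ≢ μ y
          v≢μy eq = unmixed (proj₁ u⇢v) (subst (_⟶ y) (sym eq) μy⟶y)
          unique : Unique L
          unique =
            (u≢y ∷ u≢x ∷ u≢v ∷ μ-≢ u ∷ (λ eq → proj₂ u⇢y (μ-flip (sym eq))) ∷ [])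
            ∷ (≢-sym x≢y ∷ ≢-sym v≢y ∷ ≢-sym (proj₂ u⇢y) ∷ μ-≢ y ∷ [])
            ∷ (≢-sym v≢x ∷ x≢μu ∷ (λ eq → proj₂ x⇢y (μ-flip (sym eq))) ∷ [])
            ∷ (≢-sym (proj₂ u⇢v) ∷ v≢μy ∷ [])
            ∷ ((λ eq → u≢y (μ-injective eq)) ∷ [])
            ∷ [] ∷ []
          μx≡v : μ x ≡ v
          μx≡v with covers unique (≤-reflexive (sym 6≡n)) (μ x)
          ... | here eq = contradiction (sym (μ-flip eq)) x≢μu
          ... | there (here eq) = contradiction eq (proj₂ x⇢y)
          ... | there (there (here eq)) = contradiction (sym eq) (μ-≢ x)
          ... | there (there (there (here eq))) = eq
          ... | there (there (there (there (here eq)))) = contradiction (sym (μ-injective eq)) u≢x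
          ... | there (there (there (there (there (here eq))))) = contradiction (μ-injective eq) x≢y
          arcs : ∀ {i j a b} → At L i a → At L j b → c4ppss i j ≡ true → a ⟶ b
          arcs zeroth (next zeroth) _ = proj₁ u⇢y
          arcs zeroth (next (next (next zeroth))) _ = proj₁ u⇢v
          arcs zeroth (next (next (next (next zeroth)))) _ = u⟶μu
          arcs (next (next zeroth)) (next zeroth) _ = proj₁ x⇢y
          arcs (next (next zeroth)) (next (next (next zeroth))) _ = subst (x ⟶_) μx≡v x⟶μx
          arcs (next (next (next (next (next zeroth))))) (next zeroth) _ = μy⟶y

        Tight : Set
        Tight = ∀ {s t} → s ⇢ t → (s , t) ∉ (u , v) ∷ (x , y) ∷ [] → ∀ {a b} → a ⇢ b → Touch s t a b

        -- An arc sharing a tail or a head with both `u → v` and `x → y` is `u → y` or `x → v`, and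
        -- `x → v` is disjoint from `u → y`.
        no-fourth : Tight → ¬ 4 ≤ m
        no-fourth tight 4≤m with another-arc ((u , y) ∷ (u , v) ∷ (x , y) ∷ []) 4≤m
        ... | s , t , s⇢t , new
          with touch-ends s⇢t u⇢v (tight s⇢t (new ∘ there) u⇢v)
             | touch-ends s⇢t x⇢y (tight s⇢t (new ∘ there) x⇢y)
             | touch-ends s⇢t u⇢y (tight s⇢t (new ∘ there) u⇢y)
        ...   | inj₁ refl | inj₁ refl | _ = u≢x refl
        ...   | inj₁ refl | inj₂ refl | _ = new (here refl)
        ...   | inj₂ refl | inj₂ refl | _ = v≢y refl
        ...   | inj₂ refl | inj₁ refl | inj₁ refl = u≢x refl
        ...   | inj₂ refl | inj₁ refl | inj₂ refl = v≢y refl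

      -- A third arc meets both disjoint arcs, so it takes the tail of one and the head of the
      -- other.
      third : 3 ≤ m →
        (∀ {s t} → s ⇢ t → (s , t) ∉ (u , v) ∷ (x , y) ∷ [] → ∀ {a b} → a ⇢ b → Touch s t a b) →
        u ⇢ y ⊎ x ⇢ v
      third 3≤m tight with another-arc ((u , v) ∷ (x , y) ∷ []) 3≤m
      ... | s , t , s⇢t , new with touch-ends s⇢t u⇢v (tight s⇢t new u⇢v) | touch-ends s⇢t x⇢y (tight s⇢t new x⇢y)
      ...   | inj₁ refl | inj₁ refl = contradiction refl u≢x
      ...   | inj₁ refl | inj₂ refl = inj₁ s⇢t
      ...   | inj₂ refl | inj₁ refl = inj₂ s⇢t
      ...   | inj₂ refl | inj₂ refl = contradiction refl v≢y

  -- What `Δ = 2` amounts to: the two orderings of one disjoint pair exhaust `Δ`, so any further arc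
  -- outside `μ` meets all of them.
  record Configuration : Set where
    field
      {u v x y} : Fin n
      u⇢v       : u ⇢ v
      x⇢y       : x ⇢ y
      apart-uvxy : ¬ Touch u v x y
      tight     : ∀ {s t} → s ⇢ t → (s , t) ∉ (u , v) ∷ (x , y) ∷ [] → ∀ {a b} → a ⇢ b → Touch s t a b

  -- Interchanging the two disjoint arcs turns the case `x ⇢ v` into the case `u ⇢ y`.
  exchange : Configuration → Configuration
  exchange c = record
    { u⇢v = x⇢y ; x⇢y = u⇢v ; apart-uvxy = apart-uvxy ∘ Touch-sym
    ; tight = λ s⇢t ∉ → tight s⇢t (λ { (here eq) → ∉ (there (here eq)) ; (there (here eq)) → ∉ (here eq) }) }
    where open Configuration c

  configuration : Δ ≢ 0 → Δ ≤ 2 → Configuration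
  configuration Δ≢0 Δ≤2 with Δ≢0⇒apart Δ≢0
  ... | u , v , x , y , u⇢v , x⇢y , ¬t = record
    { u⇢v = u⇢v ; x⇢y = x⇢y ; apart-uvxy = ¬t ; tight = tight }
    where
    tight : ∀ {s t} → s ⇢ t → (s , t) ∉ (u , v) ∷ (x , y) ∷ [] → ∀ {a b} → a ⇢ b → Touch s t a b
    tight {s} {t} s⇢t ∉uvxy {a} {b} a⇢b with touch? s t a b
    ... | yes touch = touch
    ... | no ¬t′ = contradiction Δ≤2 (<⇒≱ (Δ-≥3 u⇢v x⇢y ¬t s⇢t ∉uvxy a⇢b ¬t′))

  PathConclusion : Set
  PathConclusion = (6 ≡ n → n ≤ ∑₂ (λ i j → χ (c4ppss (toℕ i) (toℕ j))) → IsoTo D c4ppss) × ¬ 4 ≤ m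

  path : Unmixed → (c : Configuration) → Configuration.u c ⇢ Configuration.y c → PathConclusion
  path unmixed c u⇢y =
    six-vertices unmixed u⇢v x⇢y apart-uvxy u⇢y , no-fourth unmixed u⇢v x⇢y apart-uvxy u⇢y tight
    where open Configuration c

  at-least-three : Unmixed → 3 ≤ m → Configuration → PathConclusion
  at-least-three unmixed 3≤m c =
    [ path unmixed c , path unmixed (exchange c) ]′ (third unmixed u⇢v x⇢y apart-uvxy 3≤m tight)
    where open Configuration c

  exactly-two : Unmixed → Configuration → 4 ≡ n → n ≤ ∑₂ (λ i j → χ (c4ss (toℕ i) (toℕ j))) → IsoTo D c4ss
  exactly-two unmixed c = four-vertices unmixed u⇢v x⇢y apart-uvxy
    where open Configuration c

  Λ≡0⇒unmixed : Λ ≡ 0 → Unmixed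
  Λ≡0⇒unmixed Λ≡0 xz zy = contradiction (≤-trans (mixed-≥1 xz zy) (≤-reflexive Λ≡0)) λ ()

-- Assembling the classification

c4ss-arcs : FinSums.∑₂ 4 (λ i j → χ (c4ss (toℕ i) (toℕ j))) ≡ 4
c4ss-arcs = refl

c4ppss-arcs : FinSums.∑₂ 6 (λ i j → χ (c4ppss (toℕ i) (toℕ j))) ≡ 6
c4ppss-arcs = refl

-- For `m = 2` the disjoint pair exhausts the arcs outside `μ`, for `m = 3` there is one more, and a
-- fourth is impossible. The vertex lists start at a source, so the first entry of `extra m` always
-- fits.
classify-apart : ∀ m {D : Digraph (2 * m)} (X : MatchedOrientation m D) → 2 ≤ m →
  Apart.Unmixed X → Apart.Configuration X → Any (IsoTo D) (extra m)
classify-apart 1 X (s≤s ()) _ _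
classify-apart 2 X _ unmixed c =
  here (Apart.exactly-two X unmixed c refl (≤-reflexive (sym c4ss-arcs)))
classify-apart 3 X _ unmixed c =
  here (proj₁ (Apart.at-least-three X unmixed ≤-refl c) refl (≤-reflexive (sym c4ppss-arcs)))
classify-apart (suc (suc (suc (suc k)))) X _ unmixed c = contradiction (m≤m+n 4 k)
  (proj₂ (Apart.at-least-three X unmixed (m≤m+n 3 (suc k)) c))

Λ-reverse : ∀ {m D} (X : MatchedOrientation m D) → Structure.Λ (reverse X) ≡ Structure.Λ X
Λ-reverse {m} {D} X = ∑-cong (FinSums.V (2 * m)) λ u → *-comm (indeg D u) (outdeg D u)

-- When the spoke enters the centre, all arcs are reversed, which leads to the third entry of
-- `Ufour`.
classify-star : ∀ {m D} (X : MatchedOrientation m D) → Structure.Λ X ≤ 1 → Shape.Star X → Any (IsoTo D) Ufour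
classify-star X Λ≤1 star with Shape.Star.spoke star
... | inj₁ w⇢a = here (SourceStar.star-out X Λ≤1 through w⇢a spoke′)
  where open Shape.Star star
... | inj₂ a⇢w = there (there (here (flip-isoTo (Uarc true)
  (SourceStar.star-out (reverse X) (≤-trans (≤-reflexive (Λ-reverse X)) Λ≤1)
    (swap ∘ through ∘ unflip) (reflip a⇢w) (swap (Data.Sum.map reflip reflip spoke′))))))
  where
  open Shape.Star star
  open Structure X using (_⇢_ ; μ-flip)
  open Structure (reverse X) using () renaming (_⇢_ to _⇢ʳ_)
  unflip : ∀ {u v} → u ⇢ʳ v → v ⇢ u
  unflip (vu , ≢v) = vu , ≢v ∘ μ-flip
  reflip : ∀ {u v} → v ⇢ u → u ⇢ʳ v
  reflip (vu , ≢v) = vu , ≢v ∘ μ-flip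

-- The orientations of U_{2m,m} attain the bound

UArc-matched : ∀ {ab i j p} → UArc ab i j → UArc ab i p ⊎ UArc ab p i →
  i ≡ 0 ⊎ j ≡ p ⊎ (p ≡ 0 × i ≢ 3)
UArc-matched (spoke _) _ = inj₁ refl
-- A tail other than `0` is some y_j, whose only neighbour is its x_j, or the tail of the chord,
-- whose only neighbours are the head of the chord and `0`.
UArc-matched (inward _) (inj₁ (inward _)) = inj₂ (inj₁ refl)
UArc-matched (inward {k = k} even) (inj₂ (spoke nb)) = contradiction nb (odd-suc k even)
UArc-matched (inward {k = k} even) (inj₂ (inward odd)) = contradiction odd (odd-suc k even)
UArc-matched chord (inj₁ chord) = inj₂ (inj₁ refl)
UArc-matched chord (inj₂ (spoke _)) = inj₂ (inj₂ (refl , λ ()))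
UArc-matched chord′ (inj₁ chord′) = inj₂ (inj₁ refl)
UArc-matched chord′ (inj₂ (spoke _)) = inj₂ (inj₂ (refl , λ ()))

UArc-pendant : ∀ {ab i p} → i ≡ 3 → UArc ab i p ⊎ UArc ab p i → p ≡ 0
UArc-pendant refl (inj₂ (spoke _)) = refl

middle-position : Bool → ℕ
middle-position ab = if ab then 1 else 2

final-position : Bool → ℕ
final-position ab = if ab then 2 else 1

-- All vertices except the tail of the chord are sources or sinks, so two consecutive arcs run from
-- the centre along the chord.
UArc-path : ∀ {ab i k j} → UArc ab i k → UArc ab k j →
  i ≡ 0 × k ≡ middle-position ab × j ≡ final-position ab
UArc-path (spoke ()) (spoke _)
UArc-path (spoke nb) (inward {k = k} even) = contradiction nb (odd-suc k even)
UArc-path (spoke _) chord = refl , refl , refl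
UArc-path (spoke _) chord′ = refl , refl , refl
UArc-path (inward odd) (inward {k = k} even) = contradiction odd (odd-suc k even)

module Recognition {m : ℕ} {D : Digraph (2 * m)} (X : MatchedOrientation m D) (2≤m : 2 ≤ m)
  (ab : Bool) (iso : IsoTo D (Uarc ab)) where

  open Structure X public

  private
    σ : Permutation′ n
    σ = proj₁ iso

    pos : Fin n → ℕ
    pos u = toℕ (σ ⟨$⟩ʳ u)

    pos-injective : ∀ {u v} → pos u ≡ pos v → u ≡ v
    pos-injective eq = trans (sym (inverseˡ σ)) (trans (cong (σ ⟨$⟩ˡ_) (Fin.toℕ-injective eq)) (inverseˡ σ))

    uarc : ∀ {u v} → u ⟶ v → UArc ab (pos u) (pos v)
    uarc {u} {v} uv = Uarc⇒UArc ab (pos u) (pos v) (trans (sym (proj₂ iso u v)) uv)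

    μ-uarc : ∀ u → UArc ab (pos u) (pos (μ u)) ⊎ UArc ab (pos (μ u)) (pos u)
    μ-uarc u = Data.Sum.map uarc uarc (μ-arc u)

    3<n : 3 < n
    3<n = *-monoʳ-≤ 2 2≤m

    pendant : Fin n
    pendant = σ ⟨$⟩ˡ fromℕ< 3<n

    pos-pendant : pos pendant ≡ 3
    pos-pendant = trans (cong toℕ (inverseʳ σ)) (Fin.toℕ-fromℕ< 3<n)

    -- The vertex at position 3 can only be matched to the one at position 0. Hence, whatever the
    -- perfect matching, it contains the chord and all arcs y_j → x_j.
    unmatched-from-0 : ∀ {u v} → u ⇢ v → pos u ≡ 0
    unmatched-from-0 {u} {v} (uv , ≢v) with UArc-matched (uarc uv) (μ-uarc u)
    ... | inj₁ ≡0 = ≡0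
    ... | inj₂ (inj₁ eq) = contradiction (sym (pos-injective eq)) ≢v
    -- The pendent vertex is matched to position `0` as well, so `u` would be that vertex, at
    -- position `3`.
    ... | inj₂ (inj₂ (≡0 , ≢3)) = contradiction
      (trans (cong pos (μ-injective (pos-injective (trans ≡0 (sym (UArc-pendant pos-pendant (μ-uarc pendant)))))))
        pos-pendant) ≢3

    -- All arcs outside `μ` share their tail, the vertex at position `0`, so no two of them are
    -- disjoint.
    Δ≡0 : Δ ≡ 0
    Δ≡0 with Δ Data.Nat.≟ 0
    ... | yes eq = eq
    ... | no ≢0 = let _ , _ , _ , _ , uv , xy , ¬t = Δ≢0⇒apart ≢0 in
      contradiction (inj₁ (inj₁ (pos-injective (trans (unmatched-from-0 uv) (sym (unmatched-from-0 xy)))))) ¬t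

    ∑-≤1 : (f : Fin n → ℕ) → (∀ x → f x ≢ 0 → f x ≤ 1) → (∀ {x y} → f x ≢ 0 → f y ≢ 0 → x ≡ y) → ∑ V f ≤ 1
    ∑-≤1 f f≤1 single with ∑ V f Data.Nat.≟ 0
    ... | yes ≡0 = ≤-trans (≤-reflexive ≡0) z≤n
    ... | no ≢0 = let x , _ , fx = ∑-≢0 V {f} ≢0 in
      ≤-trans (∑-support {ys = x ∷ []} f (allFin⁺ n) (λ _ fy → here (single fy fx)))
        (≤-trans (≤-reflexive (+-identityʳ (f x))) (f≤1 x fx))

    out-arc : ∀ {u} → d⁺ u ≢ 0 → ∃ λ v → u ⟶ v
    out-arc ≢0 = let v , _ , ≢0′ = ∑-≢0 V ≢0 in v , χ≢0 ≢0′

    in-arc : ∀ {u} → d⁻ u ≢ 0 → ∃ λ v → v ⟶ u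
    in-arc ≢0 = let v , _ , ≢0′ = ∑-≢0 V ≢0 in v , χ≢0 ≢0′

    -- Only the tail of the chord can contribute, with one arc in from the centre and one arc out to
    -- the head of the chord.
    Λ≤1 : Λ ≤ 1
    Λ≤1 = ∑-≤1 (λ u → d⁺ u * d⁻ u) degrees single
      where
      path : ∀ {u} → d⁺ u * d⁻ u ≢ 0 → ∃₂ λ x y → x ⟶ u × u ⟶ y
      path {u} ≢0 = let y , uy = out-arc (*≢0ˡ (d⁺ u) ≢0) ; x , xu = in-arc (*≢0ʳ (d⁺ u) ≢0) in x , y , xu , uy
      single : ∀ {u v} → d⁺ u * d⁻ u ≢ 0 → d⁺ v * d⁻ v ≢ 0 → u ≡ v
      single u≢0 v≢0 with path u≢0 | path v≢0
      ... | _ , _ , xu , uy | _ , _ , xv , vy = pos-injective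
        (trans (proj₁ (proj₂ (UArc-path (uarc xu) (uarc uy)))) (sym (proj₁ (proj₂ (UArc-path (uarc xv) (uarc vy))))))
      degrees : ∀ u → d⁺ u * d⁻ u ≢ 0 → d⁺ u * d⁻ u ≤ 1
      degrees u ≢0 with path ≢0
      ... | x , y , xu , uy = *-mono-≤
        (∑-≤1 (λ v → χ (D u v)) (λ v _ → χ≤1 (D u v)) λ uv uv′ →
          pos-injective (trans (final (χ≢0 uv)) (sym (final (χ≢0 uv′)))))
        (∑-≤1 (λ v → χ (D v u)) (λ v _ → χ≤1 (D v u)) λ vu vu′ →
          pos-injective (trans (initial (χ≢0 vu)) (sym (initial (χ≢0 vu′)))))
        where
        final : ∀ {v} → u ⟶ v → pos v ≡ final-position ab
        final uv = proj₂ (proj₂ (UArc-path (uarc xu) (uarc uv)))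
        initial : ∀ {v} → v ⟶ u → pos v ≡ 0
        initial vu = proj₁ (UArc-path (uarc vu) (uarc uy))

  defect-≤2 : 2 * Λ + Δ ≤ 2
  defect-≤2 = +-mono-≤ (*-monoʳ-≤ 2 Λ≤1) (≤-reflexive Δ≡0)

-- Invariance under isomorphism and the small exceptional graphs

twiceM1-iso : ∀ {n} {D : Digraph n} E → IsoTo D E → twiceM1 D ≡ twiceM1 {n} (λ i j → E (toℕ i) (toℕ j))
twiceM1-iso {n} {D} E (σ , eq) = begin
  twiceM1 D
    ≡⟨ twiceM1-squares D ⟩
  ∑[ u ∈ V ] (outdeg D u * outdeg D u) + ∑[ u ∈ V ] (indeg D u * indeg D u)
    ≡⟨ cong₂ _+_ (∑-cong V λ u → cong (λ k → k * k) (out u)) (∑-cong V λ u → cong (λ k → k * k) (in′ u)) ⟩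
  ∑[ u ∈ V ] (outdeg D′ (σ ⟨$⟩ʳ u) * outdeg D′ (σ ⟨$⟩ʳ u)) + ∑[ u ∈ V ] (indeg D′ (σ ⟨$⟩ʳ u) * indeg D′ (σ ⟨$⟩ʳ u))
    ≡⟨ cong₂ _+_ (∑-permute σ (λ i → outdeg D′ i * outdeg D′ i)) (∑-permute σ (λ i → indeg D′ i * indeg D′ i)) ⟩
  ∑[ i ∈ V ] (outdeg D′ i * outdeg D′ i) + ∑[ i ∈ V ] (indeg D′ i * indeg D′ i)
    ≡⟨ sym (twiceM1-squares D′) ⟩
  twiceM1 D′ ∎
  where
  open ≡-Reasoning
  open FinSums n
  D′ : Digraph n
  D′ i j = E (toℕ i) (toℕ j)
  out : ∀ u → outdeg D u ≡ outdeg D′ (σ ⟨$⟩ʳ u)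
  out u = trans (∑-cong V λ v → cong χ (eq u v)) (∑-permute σ (λ j → χ (D′ (σ ⟨$⟩ʳ u) j)))
  in′ : ∀ u → indeg D u ≡ indeg D′ (σ ⟨$⟩ʳ u)
  in′ u = trans (∑-cong V λ v → cong χ (eq v u)) (∑-permute σ (λ j → χ (D′ j (σ ⟨$⟩ʳ u))))

-- Once transported to the standard labels, `twiceM1` of these fixed digraphs is evaluated by
-- computation.
extra-extremal : ∀ m {D : Digraph (2 * m)} → Any (IsoTo D) (extra m) → 2 + twiceM1 D ≡ m * m + 7 * m
extra-extremal 2 (here iso) = cong (2 +_) (twiceM1-iso c4ss iso)
extra-extremal 2 (there (here iso)) = cong (2 +_) (twiceM1-iso (rev c4ss) iso)
extra-extremal 3 (here iso) = cong (2 +_) (twiceM1-iso c4ppss iso)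
extra-extremal 3 (there (here iso)) = cong (2 +_) (twiceM1-iso (rev c4ppss) iso)

-- The bound and its equality cases

module Extremal {m : ℕ} {D : Digraph (2 * m)} (X : MatchedOrientation m D) (2≤m : 2 ≤ m) where

  open Structure X using (Λ; Δ; twiceM1-defect; Δ-≥2; Δ≢0⇒apart)
  open Shape X using (defect-≥2; shape; unmatched-triangle-≥2; UnmatchedTriangle; Star)

  bound : 2 + twiceM1 D ≤ m * m + 7 * m
  bound = begin
    2 + twiceM1 D              ≡⟨ +-comm 2 _ ⟩
    twiceM1 D + 2              ≤⟨ +-monoʳ-≤ (twiceM1 D) (defect-≥2 2≤m) ⟩
    twiceM1 D + (2 * Λ + Δ)    ≡⟨ twiceM1-defect ⟩
    m * m + 7 * m              ∎
    where open ≤-Reasoning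

  extremal⇒defect : 2 + twiceM1 D ≡ m * m + 7 * m → 2 * Λ + Δ ≡ 2
  extremal⇒defect eq = +-cancelˡ-≡ (twiceM1 D) _ _ (trans twiceM1-defect (trans (sym eq) (+-comm 2 _)))

  defect⇒extremal : 2 * Λ + Δ ≤ 2 → 2 + twiceM1 D ≡ m * m + 7 * m
  defect⇒extremal le = trans (+-comm 2 _)
    (trans (cong (twiceM1 D +_) (≤-antisym (defect-≥2 2≤m) le)) twiceM1-defect)

  star-case : Λ ≤ 1 → UnmatchedTriangle ⊎ Star → InUstar m D
  star-case Λ≤1 (inj₁ (_ , _ , _ , xy , yz , xz)) =
    contradiction Λ≤1 (<⇒≱ (unmatched-triangle-≥2 xy yz xz))
  star-case Λ≤1 (inj₂ star) = ++⁺ˡ (classify-star X Λ≤1 star)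

  classify : 2 * Λ + Δ ≡ 2 → InUstar m D
  classify eq with Δ Data.Nat.≟ 0
  ... | yes Δ≡0 = star-case (*-cancelˡ-≤ 2 (≤-trans (m≤m+n (2 * Λ) Δ) (≤-reflexive eq))) (shape 2≤m Δ≡0)
  ... | no Δ≢0 = ++⁺ʳ Ufour (classify-apart m X 2≤m (Apart.Λ≡0⇒unmixed X Λ≡0) (Apart.configuration X Δ≢0 Δ≤2))
    where
    Δ≤2 : Δ ≤ 2
    Δ≤2 = ≤-trans (m≤n+m Δ (2 * Λ)) (≤-reflexive eq)
    2≤Δ : 2 ≤ Δ
    2≤Δ = let _ , _ , _ , _ , uv , xy , ¬t = Δ≢0⇒apart Δ≢0 in Δ-≥2 uv xy ¬t
    -- The disjoint pair already uses up both units of the defect.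
    Λ≡0 : Λ ≡ 0
    Λ≡0 = m+n≡0⇒m≡0 Λ (n≤0⇒n≡0 (+-cancelʳ-≤ 2 (2 * Λ) 0 (≤-trans (+-monoʳ-≤ (2 * Λ) 2≤Δ) (≤-reflexive eq))))

-- The index is unchanged by reversal, so the unreversed case is applied to the reversed digraph.
flipped-four-extremal : ∀ {m D} → MatchedOrientation m D → 2 ≤ m → ∀ ab → IsoTo D (rev (Uarc ab)) →
  2 + twiceM1 D ≡ m * m + 7 * m
flipped-four-extremal {D = D} X 2≤m ab (σ , eq) = trans (cong (2 +_) (sym (twiceM1-flip D)))
  (Extremal.defect⇒extremal (reverse X) 2≤m
    (Recognition.defect-≤2 (reverse X) 2≤m ab (σ , λ u v → eq v u)))

Ustar-extremal : ∀ {m D} → MatchedOrientation m D → 2 ≤ m → InUstar m D → 2 + twiceM1 D ≡ m * m + 7 * m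
Ustar-extremal X 2≤m (here iso) = Extremal.defect⇒extremal X 2≤m (Recognition.defect-≤2 X 2≤m true iso)
Ustar-extremal X 2≤m (there (here iso)) = Extremal.defect⇒extremal X 2≤m (Recognition.defect-≤2 X 2≤m false iso)
Ustar-extremal X 2≤m (there (there (here iso))) = flipped-four-extremal X 2≤m true iso
Ustar-extremal X 2≤m (there (there (there (here iso)))) = flipped-four-extremal X 2≤m false iso
Ustar-extremal {m} X 2≤m (there (there (there (there iso)))) = extra-extremal m iso

-- From a maximum matching of the graph to the involution `μ`

length-endpoints : ∀ {n} (M : List (Fin n × Fin n)) → length (endpoints M) ≡ 2 * length M
length-endpoints [] = refl
length-endpoints (_ ∷ M) = trans (cong (2 +_) (length-endpoints M)) (sym (*-suc 2 (length M)))

module _ {n : ℕ} where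

  Linked : List (Fin n × Fin n) → Fin n → Fin n → Set
  Linked M u v = (u , v) ∈ M ⊎ (v , u) ∈ M

  partner : ∀ M {u} → u ∈ endpoints M → ∃ (Linked M u)
  partner ((a , b) ∷ M) (here refl) = b , inj₁ (here refl)
  partner ((a , b) ∷ M) (there (here refl)) = a , inj₂ (here refl)
  partner (_ ∷ M) (there (there u∈)) = let v , l = partner M u∈ in v , Data.Sum.map there there l

  Linked-∈ : ∀ M {u v} → Linked M u v → u ∈ endpoints M
  Linked-∈ (_ ∷ _) (inj₁ (here refl)) = here refl
  Linked-∈ (_ ∷ _) (inj₂ (here refl)) = there (here refl)
  Linked-∈ (_ ∷ M) (inj₁ (there p)) = there (there (Linked-∈ M (inj₁ p)))
  Linked-∈ (_ ∷ M) (inj₂ (there p)) = there (there (Linked-∈ M (inj₂ p)))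

  Linked-∷ : ∀ {a b M u v} → Linked ((a , b) ∷ M) u v → ((u ≡ a × v ≡ b) ⊎ (u ≡ b × v ≡ a)) ⊎ Linked M u v
  Linked-∷ (inj₁ (here refl)) = inj₁ (inj₁ (refl , refl))
  Linked-∷ (inj₂ (here refl)) = inj₁ (inj₂ (refl , refl))
  Linked-∷ (inj₁ (there p)) = inj₂ (inj₁ p)
  Linked-∷ (inj₂ (there p)) = inj₂ (inj₂ p)

  -- A second matching edge at `u` would repeat `u` among the endpoints.
  Linked-functional : ∀ M → Unique (endpoints M) → ∀ {u v w} → Linked M u v → Linked M u w → v ≡ w
  Linked-functional [] _ (inj₁ ())
  Linked-functional [] _ (inj₂ ())
  Linked-functional ((a , b) ∷ M) ((a≢b ∷ a∉) ∷ b∉ ∷ uniq) l l′ with Linked-∷ l | Linked-∷ l′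
  ... | inj₂ p | inj₂ p′ = Linked-functional M uniq p p′
  ... | inj₁ (inj₁ (refl , refl)) | inj₁ (inj₁ (_ , refl)) = refl
  ... | inj₁ (inj₂ (refl , refl)) | inj₁ (inj₂ (_ , refl)) = refl
  ... | inj₁ (inj₁ (refl , _)) | inj₁ (inj₂ (u≡b , _)) = contradiction u≡b a≢b
  ... | inj₁ (inj₂ (refl , _)) | inj₁ (inj₁ (u≡a , _)) = contradiction (sym u≡a) a≢b
  ... | inj₁ (inj₁ (refl , _)) | inj₂ p = contradiction refl (All.lookup a∉ (Linked-∈ M p))
  ... | inj₁ (inj₂ (refl , _)) | inj₂ p = contradiction refl (All.lookup b∉ (Linked-∈ M p))
  ... | inj₂ p | inj₁ (inj₁ (refl , _)) = contradiction refl (All.lookup a∉ (Linked-∈ M p))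
  ... | inj₂ p | inj₁ (inj₂ (refl , _)) = contradiction refl (All.lookup b∉ (Linked-∈ M p))

xor-true : ∀ {b c} → b xor c ≡ true → b ≡ true ⊎ c ≡ true
xor-true {true} _ = inj₁ refl
xor-true {false} eq = inj₂ eq

<ᵇ-exactly-one : ∀ a b → a ≢ b → χ (a <ᵇ b) + χ (b <ᵇ a) ≡ 1
<ᵇ-exactly-one zero zero a≢b = contradiction refl a≢b
<ᵇ-exactly-one zero (suc b) _ = refl
<ᵇ-exactly-one (suc a) zero _ = refl
<ᵇ-exactly-one (suc a) (suc b) a≢b = <ᵇ-exactly-one a b (a≢b ∘ cong suc)

module _ {n : ℕ} (G : SimpleGraph n) (D : Digraph n) (orientation : IsOrientation G D) where

  open FinSums n

  arc-loopless : ∀ {u} → D u u ≢ true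
  arc-loopless {u} uu = contradiction (trans (sym (proj₁ (orientation u u) uu)) (irrefl G u)) λ ()

  arc-asymmetric : ∀ {u v} → D u v ≡ true → D v u ≢ true
  arc-asymmetric {u} {v} uv vu with proj₁ (orientation u v) uv | proj₂ (orientation u v)
  ... | adj | eq rewrite uv | vu = contradiction (trans (sym adj) eq) λ ()

  -- Both sides are doubled so that every unordered pair is counted from each of its ends; the two
  -- sums then agree term by term.
  orientation-arc-count : ∑₂ (λ u v → χ (D u v)) ≡ edgeCount G
  orientation-arc-count = *-cancelˡ-≡ _ _ 2 (begin
    2 * ∑₂ (λ u v → χ (D u v))           ≡⟨ double (λ u v → χ (D u v)) ⟩
    ∑₂ (λ u v → χ (D u v) + χ (D v u))   ≡⟨ ∑₂-cong (λ u v → trans (arcs u v) (sym (edges u v))) ⟩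
    ∑₂ (λ u v → edge u v + edge v u)     ≡⟨ sym (double edge) ⟩
    2 * edgeCount G                      ∎)
    where
    open ≡-Reasoning
    edge : Fin n → Fin n → ℕ
    edge u v = χ (adj G u v ∧ (toℕ u <ᵇ toℕ v))
    double : ∀ f → 2 * ∑₂ f ≡ ∑₂ (λ u v → f u v + f v u)
    double f = trans (cong (∑₂ f +_) (trans (+-identityʳ _) (∑₂-swap f))) (sym (∑₂-+ f (λ u v → f v u)))
    arcs : ∀ u v → χ (D u v) + χ (D v u) ≡ χ (adj G u v)
    arcs u v rewrite proj₂ (orientation u v) with D u v in uv | D v u in vu
    ... | true | true = contradiction vu (arc-asymmetric uv)
    ... | true | false = refl
    ... | false | true = refl
    ... | false | false = refl
    edges : ∀ u v → edge u v + edge v u ≡ χ (adj G u v)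
    edges u v rewrite SimpleGraph.sym G v u with adj G u v in uv
    ... | false = refl
    ... | true = <ᵇ-exactly-one (toℕ u) (toℕ v)
      λ eq → loop (Fin.toℕ-injective eq) uv
      where
      loop : ∀ {u v} → u ≡ v → adj G u v ≢ true
      loop refl uu = contradiction (trans (sym uu) (irrefl G _)) λ ()

-- The `m` matching edges have `2 * m` distinct endpoints, hence cover every vertex, and the partner
-- map is defined everywhere.
matchedOrientation : ∀ {m} (G : SimpleGraph (2 * m)) → edgeCount G ≡ 2 * m → MatchingNumber G m →
  (D : Digraph (2 * m)) → IsOrientation G D → MatchedOrientation m D
matchedOrientation {m} G edges ((M , (M-edges , M-unique) , M-length) , _) D orientation = record
  { μ = μ
  ; μ-involutive = λ u → Linked-functional M M-unique (linked (μ u)) (swap (linked u))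
  ; μ-arc = λ u → xor-true (trans (sym (proj₂ (orientation u (μ u)))) (adjacent (linked u)))
  ; loopless = arc-loopless G D orientation
  ; asymmetric = arc-asymmetric G D orientation
  ; arc-count = trans (orientation-arc-count G D orientation) edges
  }
  where
  partners : ∀ u → ∃ (Linked M u)
  partners u = partner M (covers M-unique
    (≤-reflexive (sym (trans (length-endpoints M) (cong (2 *_) M-length)))) u)
  μ : Fin (2 * m) → Fin (2 * m)
  μ u = proj₁ (partners u)
  linked : ∀ u → Linked M u (μ u)
  linked u = proj₂ (partners u)
  adjacent : ∀ {u v} → Linked M u v → adj G u v ≡ true
  adjacent (inj₁ uv∈) = All.lookup M-edges uv∈
  adjacent {u} {v} (inj₂ vu∈) = trans (SimpleGraph.sym G u v) (All.lookup M-edges vu∈)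

theorem2 : (m : ℕ) → 2 ≤ m → (G : SimpleGraph (2 * m)) → ConnectedUnicyclic G → MatchingNumber G m
    → (D : Digraph (2 * m)) → IsOrientation G D
    → (2 + twiceM1 D ≤ m * m + 7 * m) × ((2 + twiceM1 D ≡ m * m + 7 * m) ⇔ InUstar m D)
theorem2 m 2≤m G (_ , edges) matching D orientation =
  Extremal.bound X 2≤m , mk⇔ (Extremal.classify X 2≤m ∘ Extremal.extremal⇒defect X 2≤m) (Ustar-extremal X 2≤m)
  where
  X : MatchedOrientation m D
  X = matchedOrientation G edges matching D orientation
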